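{- Let $n\in\mathbb{N}$, $i\in\{1,\ldots,n\}$ and $x\in\mathcal{X}^n$. Then \[ x_i \ge \frac{1}{(n-i+1)(s_i-1)}, \] with equality if and only if $x = \bar x(i)$.
   Context: The Sylvester sequence: $s_1 = 2$, $s_i = \prod_{j=1}^{i-1} s_j + 1$ for $i\ge2$. $\mathcal{X}^n$ is the set of $x\in\mathbb{R}^n$ with $x_1+\cdots+x_n = 1$, $1 \ge x_1 \ge \cdots \ge x_n \ge 0$, and $x_1\cdots x_j \le x_{j+1}+\cdots+x_n$ for all $j\in\{1,\ldots,n-1\}$. For $l\in\{1,\ldots,n\}$, $\bar x(l) := \big(\frac{1}{s_1},\ldots,\frac{1}{s_{l-1}}, \frac{1}{(n-l+1)(s_l-1)},\ldots,\frac{1}{(n-l+1)(s_l-1)}\big)\in\mathbb{R}^n$ (last value repeated $n-l+1$ times). -}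

module Defs where

open import Data.Bool.Base using (if_then_else_)
open import Data.Fin.Base as Fin using (Fin; toℕ)
open import Data.Fin.Properties using (toℕ<n; _<?_)
open import Data.Integer.Base using (1ℤ)
open import Data.List.Base using (List; foldr; take; drop)
open import Data.Nat.Base as ℕ using (ℕ; zero; suc; NonZero; >-nonZero)
import Data.Nat.Properties as ℕ
open import Data.Product.Base using (∃-syntax; _,_; _×_)
open import Data.Rational.Base as ℚ using (ℚ; 0ℚ; 1ℚ; ½; ∣_∣; _-_; 1/_; Positive; positive)
import Data.Rational.Properties as ℚ
open import Data.Rational.Solver using (module +-*-Solver)
open import Data.Vec.Functional using (Vector; toList)
open import Relation.Binary.PropositionalEquality
open import Relation.Nullary.Decidable.Core using (does)

-- Real numbers: Cauchy sequences of rationals, considered up to _≃_ (that is,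
-- modulo null sequences) with pointwise arithmetic.

Eventually : (ℕ → Set) → Set
Eventually P = ∃[ N ] (∀ n → N ℕ.≤ n → P n)

IsCauchy : (ℕ → ℚ) → Set
IsCauchy u = ∀ ε → 0ℚ ℚ.< ε →
  ∃[ N ] (∀ m n → N ℕ.≤ m → N ℕ.≤ n → ∣ u m - u n ∣ ℚ.< ε)

record ℝ : Set where
  constructor mkℝ
  field
    seq    : ℕ → ℚ
    cauchy : IsCauchy seq

open ℝ public

infix 4 _≃_ _≤_ _≥_

record _≃_ (x y : ℝ) : Set where
  constructor mk≃
  field
    close : ∀ ε → 0ℚ ℚ.< ε → Eventually λ n → ∣ seq x n - seq y n ∣ ℚ.< ε

-- Constructively equivalent to the negation of
-- y < x, i.e. of  ∃ ε > 0, eventually  yₙ + ε ≤ xₙ.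
record _≤_ (x y : ℝ) : Set where
  constructor mk≤
  field
    below : ∀ ε → 0ℚ ℚ.< ε → Eventually λ n → seq x n ℚ.< seq y n ℚ.+ ε

open _≃_ public
open _≤_ public

_≥_ : ℝ → ℝ → Set
x ≥ y = y ≤ x

private abstract
  +-split : ∀ a b c d → (a ℚ.+ b) - (c ℚ.+ d) ≡ (a - c) ℚ.+ (b - d)
  +-split = solve 4 (λ a b c d → (a :+ b) :- (c :+ d) := (a :- c) :+ (b :- d)) refl
    where open +-*-Solver

  +-insert : ∀ a b → a ≡ (a - b) ℚ.+ b
  +-insert = solve 2 (λ a b → a := (a :- b) :+ b) refl
    where open +-*-Solver

  *-split : ∀ a b c d → a ℚ.* b - c ℚ.* d ≡ a ℚ.* (b - d) ℚ.+ d ℚ.* (a - c)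
  *-split = solve 4 (λ a b c d → a :* b :- c :* d := a :* (b :- d) :+ d :* (a :- c)) refl
    where open +-*-Solver

  ∣p-p∣≡0 : ∀ p → ∣ p - p ∣ ≡ 0ℚ
  ∣p-p∣≡0 p = cong ∣_∣ (ℚ.+-inverseʳ p)

  half-pos : ∀ {ε} → 0ℚ ℚ.< ε → 0ℚ ℚ.< ½ ℚ.* ε
  half-pos {ε} 0<ε = subst (ℚ._< ½ ℚ.* ε) (ℚ.*-zeroʳ ½) (ℚ.*-monoʳ-<-pos ½ 0<ε)

  half+half : ∀ ε → ½ ℚ.* ε ℚ.+ ½ ℚ.* ε ≡ ε
  half+half ε = trans (sym (ℚ.*-distribʳ-+ ε ½ ½)) (ℚ.*-identityˡ ε)

  +-cauchy : ∀ {u v} → IsCauchy u → IsCauchy v → IsCauchy (λ n → u n ℚ.+ v n)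
  +-cauchy {u} {v} cu cv ε 0<ε with cu (½ ℚ.* ε) (half-pos 0<ε) | cv (½ ℚ.* ε) (half-pos 0<ε)
  ... | M , p | N , q = M ℕ.⊔ N , λ m n M⊔N≤m M⊔N≤n → begin-strict
    ∣ (u m ℚ.+ v m) - (u n ℚ.+ v n) ∣
      ≡⟨ cong ∣_∣ (+-split (u m) (v m) (u n) (v n)) ⟩
    ∣ (u m - u n) ℚ.+ (v m - v n) ∣
      ≤⟨ ℚ.∣p+q∣≤∣p∣+∣q∣ (u m - u n) (v m - v n) ⟩
    ∣ u m - u n ∣ ℚ.+ ∣ v m - v n ∣
      <⟨ ℚ.+-mono-< (p m n (ℕ.m⊔n≤o⇒m≤o M N M⊔N≤m) (ℕ.m⊔n≤o⇒m≤o M N M⊔N≤n))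
                    (q m n (ℕ.m⊔n≤o⇒n≤o M N M⊔N≤m) (ℕ.m⊔n≤o⇒n≤o M N M⊔N≤n)) ⟩
    ½ ℚ.* ε ℚ.+ ½ ℚ.* ε
      ≡⟨ half+half ε ⟩
    ε ∎
    where
    open ℚ.≤-Reasoning

  eventually-bounded : ∀ {u} → IsCauchy u →
    ∃[ B ] (Positive B × Eventually λ n → ∣ u n ∣ ℚ.≤ B)
  eventually-bounded {u} cu with cu 1ℚ (ℚ.positive⁻¹ 1ℚ)
  ... | N , p = 1ℚ ℚ.+ ∣ u N ∣ ,
      ℚ.pos+nonNeg⇒pos 1ℚ ∣ u N ∣ {{ℚ.∣-∣-nonNeg (u N)}} ,
      N , λ n N≤n → begin
        ∣ u n ∣                       ≡⟨ cong ∣_∣ (+-insert (u n) (u N)) ⟩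
        ∣ (u n - u N) ℚ.+ u N ∣       ≤⟨ ℚ.∣p+q∣≤∣p∣+∣q∣ (u n - u N) (u N) ⟩
        ∣ u n - u N ∣ ℚ.+ ∣ u N ∣     ≤⟨ ℚ.+-monoˡ-≤ ∣ u N ∣ (ℚ.<⇒≤ (p n N N≤n ℕ.≤-refl)) ⟩
        1ℚ ℚ.+ ∣ u N ∣                ∎
    where
    open ℚ.≤-Reasoning

  *-bound : ∀ a b B δ → Positive B → ∣ a ∣ ℚ.≤ B → ∣ b ∣ ℚ.< δ → ∣ a ℚ.* b ∣ ℚ.< B ℚ.* δ
  *-bound a b B δ B>0 a≤B b<δ = begin-strict
    ∣ a ℚ.* b ∣         ≡⟨ ℚ.∣p*q∣≡∣p∣*∣q∣ a b ⟩
    ∣ a ∣ ℚ.* ∣ b ∣     ≤⟨ ℚ.*-monoʳ-≤-nonNeg ∣ b ∣ {{ℚ.∣-∣-nonNeg b}} a≤B ⟩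
    B ℚ.* ∣ b ∣         <⟨ ℚ.*-monoʳ-<-pos B {{B>0}} b<δ ⟩
    B ℚ.* δ             ∎
    where open ℚ.≤-Reasoning

  -- δ with (B + C) δ = ε
  shrink : ∀ B C ε → Positive B → Positive C → 0ℚ ℚ.< ε →
    ∃[ δ ] (0ℚ ℚ.< δ × B ℚ.* δ ℚ.+ C ℚ.* δ ≡ ε)
  shrink B C ε B>0 C>0 0<ε = divide (B ℚ.+ C) (ℚ.pos+pos⇒pos B {{B>0}} C {{C>0}}) refl
    where
    divide : ∀ K → Positive K → B ℚ.+ C ≡ K → ∃[ δ ] (0ℚ ℚ.< δ × B ℚ.* δ ℚ.+ C ℚ.* δ ≡ ε)
    divide K K>0 B+C≡K = K⁻¹ ℚ.* ε ,
      ℚ.positive⁻¹ (K⁻¹ ℚ.* ε) {{ℚ.pos*pos⇒pos K⁻¹ {{ℚ.1/pos⇒pos K {{K>0}}}} ε {{positive 0<ε}}}} ,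
      (begin
        B ℚ.* (K⁻¹ ℚ.* ε) ℚ.+ C ℚ.* (K⁻¹ ℚ.* ε) ≡⟨ ℚ.*-distribʳ-+ (K⁻¹ ℚ.* ε) B C ⟨
        (B ℚ.+ C) ℚ.* (K⁻¹ ℚ.* ε)               ≡⟨ cong (ℚ._* (K⁻¹ ℚ.* ε)) B+C≡K ⟩
        K ℚ.* (K⁻¹ ℚ.* ε)                       ≡⟨ ℚ.*-assoc K K⁻¹ ε ⟨
        (K ℚ.* K⁻¹) ℚ.* ε                       ≡⟨ cong (ℚ._* ε) (ℚ.*-inverseʳ K {{ℚ.pos⇒nonZero K {{K>0}}}}) ⟩
        1ℚ ℚ.* ε                                ≡⟨ ℚ.*-identityˡ ε ⟩
        ε                                       ∎)
      where
      open ≡-Reasoning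
      K⁻¹ : ℚ
      K⁻¹ = (1/ K) {{ℚ.pos⇒nonZero K {{K>0}}}}

  *-close : ∀ a b c d B C δ ε → Positive B → Positive C → B ℚ.* δ ℚ.+ C ℚ.* δ ≡ ε →
    ∣ a ∣ ℚ.≤ B → ∣ d ∣ ℚ.≤ C → ∣ a - c ∣ ℚ.< δ → ∣ b - d ∣ ℚ.< δ →
    ∣ a ℚ.* b - c ℚ.* d ∣ ℚ.< ε
  *-close a b c d B C δ ε B>0 C>0 Bδ+Cδ≡ε a≤B d≤C a-c<δ b-d<δ = begin-strict
    ∣ a ℚ.* b - c ℚ.* d ∣
      ≡⟨ cong ∣_∣ (*-split a b c d) ⟩
    ∣ a ℚ.* (b - d) ℚ.+ d ℚ.* (a - c) ∣
      ≤⟨ ℚ.∣p+q∣≤∣p∣+∣q∣ (a ℚ.* (b - d)) (d ℚ.* (a - c)) ⟩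
    ∣ a ℚ.* (b - d) ∣ ℚ.+ ∣ d ℚ.* (a - c) ∣
      <⟨ ℚ.+-mono-< (*-bound a (b - d) B δ B>0 a≤B b-d<δ) (*-bound d (a - c) C δ C>0 d≤C a-c<δ) ⟩
    B ℚ.* δ ℚ.+ C ℚ.* δ
      ≡⟨ Bδ+Cδ≡ε ⟩
    ε ∎
    where open ℚ.≤-Reasoning

  *-cauchy : ∀ {u v} → IsCauchy u → IsCauchy v → IsCauchy (λ n → u n ℚ.* v n)
  *-cauchy {u} {v} cu cv ε 0<ε =
    let B , B>0 , M , u≤B = eventually-bounded {u} cu
        C , C>0 , N , v≤C = eventually-bounded {v} cv
        δ , 0<δ , Bδ+Cδ≡ε = shrink B C ε B>0 C>0 0<ε
        P , p = cu δ 0<δ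
        Q , q = cv δ 0<δ
    in (M ℕ.⊔ N) ℕ.⊔ (P ℕ.⊔ Q) , λ m n L≤m L≤n →
      let MN≤m = ℕ.m⊔n≤o⇒m≤o (M ℕ.⊔ N) (P ℕ.⊔ Q) L≤m
          PQ≤m = ℕ.m⊔n≤o⇒n≤o (M ℕ.⊔ N) (P ℕ.⊔ Q) L≤m
          MN≤n = ℕ.m⊔n≤o⇒m≤o (M ℕ.⊔ N) (P ℕ.⊔ Q) L≤n
          PQ≤n = ℕ.m⊔n≤o⇒n≤o (M ℕ.⊔ N) (P ℕ.⊔ Q) L≤n
      in *-close (u m) (v m) (u n) (v n) B C δ ε B>0 C>0 Bδ+Cδ≡ε
           (u≤B m (ℕ.m⊔n≤o⇒m≤o M N MN≤m)) (v≤C n (ℕ.m⊔n≤o⇒n≤o M N MN≤n))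
           (p m n (ℕ.m⊔n≤o⇒m≤o P Q PQ≤m) (ℕ.m⊔n≤o⇒m≤o P Q PQ≤n))
           (q m n (ℕ.m⊔n≤o⇒n≤o P Q PQ≤m) (ℕ.m⊔n≤o⇒n≤o P Q PQ≤n))

  const-cauchy : ∀ p → IsCauchy (λ _ → p)
  const-cauchy p ε 0<ε = 0 , λ _ _ _ _ → subst (ℚ._< ε) (sym (∣p-p∣≡0 p)) 0<ε

fromℚ : ℚ → ℝ
fromℚ p = mkℝ (λ _ → p) (const-cauchy p)

0ℝ 1ℝ : ℝ
0ℝ = fromℚ 0ℚ
1ℝ = fromℚ 1ℚ

infixl 6 _+_
infixl 7 _*_

_+_ : ℝ → ℝ → ℝ
x + y = mkℝ (λ n → seq x n ℚ.+ seq y n) (+-cauchy {seq x} {seq y} (cauchy x) (cauchy y))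

_*_ : ℝ → ℝ → ℝ
x * y = mkℝ (λ n → seq x n ℚ.* seq y n) (*-cauchy {seq x} {seq y} (cauchy x) (cauchy y))

∑ ∏ : List ℝ → ℝ
∑ = foldr _+_ 0ℝ
∏ = foldr _*_ 1ℝ

-- All indices below are zero-based: s k is the term usually written s_{k+1},
-- and ∏s k is the product of the first k terms.
mutual
  s : ℕ → ℕ
  s k = 1 ℕ.+ ∏s k

  ∏s : ℕ → ℕ
  ∏s zero    = 1
  ∏s (suc k) = ∏s k ℕ.* s k

-- x₁ ⋯ xⱼ and xⱼ₊₁ + ⋯ + xₙ are the product of the first j entries and the
-- sum of the remaining ones.
record 𝒳 (n : ℕ) (x : Vector ℝ n) : Set where
  field
    sum≃1      : ∑ (toList x) ≃ 1ℝ
    ≤1         : ∀ k → x k ≤ 1ℝ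
    decreasing : ∀ k l → k Fin.≤ l → x k ≥ x l
    ≥0         : ∀ k → x k ≥ 0ℝ
    prod≤sum   : ∀ j → 1 ℕ.≤ j → j ℕ.< n → ∏ (take j (toList x)) ≤ ∑ (drop j (toList x))

∏s≢0 : ∀ k → NonZero (∏s k)
∏s≢0 zero    = _
∏s≢0 (suc k) = ℕ.m*n≢0 (∏s k) (s k) {{∏s≢0 k}}

-- With one-based i this is (n - i + 1)(s_i - 1).
denominator : ∀ {n} → Fin n → ℕ
denominator {n} i = (n ℕ.∸ toℕ i) ℕ.* (s (toℕ i) ℕ.∸ 1)

denominator≢0 : ∀ {n} (i : Fin n) → NonZero (denominator i)
denominator≢0 {n} i = ℕ.m*n≢0 (n ℕ.∸ toℕ i) (s (toℕ i) ℕ.∸ 1)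
  {{>-nonZero (ℕ.m<n⇒0<n∸m (toℕ<n i))}} {{∏s≢0 (toℕ i)}}

bound : ∀ {n} → Fin n → ℝ
bound i = fromℚ ((1ℤ ℚ./ denominator i) {{denominator≢0 i}})

x̄ : ∀ {n} → Fin n → Vector ℝ n
x̄ l k = if does (k <? l) then fromℚ (1ℤ ℚ./ s (toℕ k)) else bound l

{-# OPTIONS --safe #-}
-- Write Sₖ = s₁ ⋯ sₖ, so that 1/s₁ + ⋯ + 1/sₖ = 1 - 1/Sₖ.  Since the last n - k entries
-- are at most xₖ₊₁, the bound follows from xₖ₊₁ + ⋯ + xₙ ≥ 1/Sₖ, that is, from Gₖ ≥ 0 where
-- Gₖ = Σ_{l ≤ k} (1/sₗ - xₗ).  With Qₖ = Π_{l ≤ k} sₗ xₗ, the hypothesis on products reads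
-- Qₖ - 1 ≤ Sₖ Gₖ, and by induction on k, for x = xₖ and then for every smaller x ≥ 0,
--   xᵏ ≤ Qₖ (x + Gₖ / k)ᵏ.
-- The step is AM–GM, as k + 1 times x + Gₖ₊₁ / (k + 1) equals 1/sₖ₊₁ plus k times x + Gₖ / k
-- for x = xₖ₊₁.  If Gₖ were negative, then Qₖ < 1 and the displayed inequality would fail;
-- if Gₖ = 0, then equality holds in AM–GM at every step, which forces xₗ = 1/sₗ for l ≤ k.
module Submission where

open import Data.Bool.Base using (if_then_else_)
open import Data.Empty using (⊥-elim)
open import Data.Fin.Base as Fin using (Fin; toℕ; fromℕ<)
open import Data.Fin.Properties using (toℕ<n; toℕ-fromℕ<; _<?_)
open import Data.Integer.Base as ℤ using (+_; 1ℤ)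
import Data.Integer.Properties as ℤ
open import Data.List.Base using (List; []; _∷_; take; drop; tabulate)
open import Data.Nat.Base as ℕ using (ℕ; zero; suc; z≤n; s≤s)
import Data.Nat.Properties as ℕ
open import Data.Product.Base using (_×_; _,_; proj₁; proj₂; ∃-syntax)
open import Data.Rational.Base as ℚ using (ℚ; 0ℚ; 1ℚ; ½; ∣_∣; positive; nonNegative)
import Data.Rational.Properties as ℚ
open import Data.Rational.Solver using (module +-*-Solver)
open import Data.Rational.Unnormalised.Base as ℚᵘ using (mkℚᵘ; *≡*)
import Data.Rational.Unnormalised.Properties as ℚᵘ
open import Data.Sum.Base using (_⊎_; inj₁; inj₂; [_,_]′)
open import Data.Vec.Functional using (Vector; toList)
open import Function.Bundles using (_⇔_; mk⇔)
open import Relation.Binary.PropositionalEquality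
open import Relation.Nullary using (¬_; Dec; yes; no)
open import Relation.Nullary.Decidable using (dec-true; dec-false)
open import Defs
open +-*-Solver

private variable
  x y z a b c : ℝ

-- Order and absolute value on the rationals.

-- The difference is a separate argument, so that the ring solver can match it with an expression
-- already known to be positive.
0<⇒< : ∀ {p q d} → 0ℚ ℚ.< d → q ℚ.- p ≡ d → p ℚ.< q
0<⇒< {p} {q} {d} 0<d refl = subst₂ ℚ._<_ (ℚ.+-identityʳ p)
  (solve 2 (λ p q → p :+ (q :- p) := q) refl p q) (ℚ.+-monoʳ-< p 0<d)

<⇒0< : ∀ {p q} → p ℚ.< q → 0ℚ ℚ.< q ℚ.- p
<⇒0< {p} {q} p<q = subst (ℚ._< q ℚ.- p) (ℚ.+-inverseʳ p) (ℚ.+-monoˡ-< (ℚ.- p) p<q)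

≤⇒0≤ : ∀ {p q} → p ℚ.≤ q → 0ℚ ℚ.≤ q ℚ.- p
≤⇒0≤ {p} {q} p≤q = subst (ℚ._≤ q ℚ.- p) (ℚ.+-inverseʳ p) (ℚ.+-monoˡ-≤ (ℚ.- p) p≤q)

0<p*q : ∀ {p q} → 0ℚ ℚ.< p → 0ℚ ℚ.< q → 0ℚ ℚ.< p ℚ.* q
0<p*q {p} {q} 0<p 0<q =
  ℚ.positive⁻¹ (p ℚ.* q) {{ℚ.pos*pos⇒pos p {{positive 0<p}} q {{positive 0<q}}}}

0≤p*q : ∀ {p q} → 0ℚ ℚ.≤ p → 0ℚ ℚ.≤ q → 0ℚ ℚ.≤ p ℚ.* q
0≤p*q {p} {q} 0≤p 0≤q =
  ℚ.nonNegative⁻¹ (p ℚ.* q) {{ℚ.nonNeg*nonNeg⇒nonNeg p {{nonNegative 0≤p}} q {{nonNegative 0≤q}}}}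

0<½* : ∀ {ε} → 0ℚ ℚ.< ε → 0ℚ ℚ.< ½ ℚ.* ε
0<½* = 0<p*q (ℚ.positive⁻¹ ½)

½+½ : ∀ ε → ½ ℚ.* ε ℚ.+ ½ ℚ.* ε ≡ ε
½+½ ε = trans (sym (ℚ.*-distribʳ-+ ε ½ ½)) (ℚ.*-identityˡ ε)

p≤∣p∣ : ∀ p → p ℚ.≤ ∣ p ∣
p≤∣p∣ p with ℚ.≤-total 0ℚ p
... | inj₁ 0≤p = ℚ.≤-reflexive (sym (ℚ.0≤p⇒∣p∣≡p 0≤p))
... | inj₂ p≤0 = ℚ.≤-trans p≤0 (ℚ.0≤∣p∣ p)

∣p-q∣<ε⇒p<q+ε : ∀ {p q ε} → ∣ p ℚ.- q ∣ ℚ.< ε → p ℚ.< q ℚ.+ ε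
∣p-q∣<ε⇒p<q+ε {p} {q} {ε} close = 0<⇒< (<⇒0< (ℚ.≤-<-trans (p≤∣p∣ (p ℚ.- q)) close))
  (solve 3 (λ p q ε → (q :+ ε) :- p := ε :- (p :- q)) refl p q ε)

∣p-q∣-sym : ∀ p q → ∣ p ℚ.- q ∣ ≡ ∣ q ℚ.- p ∣
∣p-q∣-sym p q = trans (sym (ℚ.∣-p∣≡∣p∣ (p ℚ.- q)))
  (cong ∣_∣ (solve 2 (λ p q → :- (p :- q) := q :- p) refl p q))

-- Arithmetic and order of the Cauchy reals.

Eventually-map₂ : ∀ {P Q R : ℕ → Set} → (∀ n → P n → Q n → R n) →
  Eventually P → Eventually Q → Eventually R
Eventually-map₂ f (M , p) (N , q) = M ℕ.⊔ N , λ n M⊔N≤n →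
  f n (p n (ℕ.m⊔n≤o⇒m≤o M N M⊔N≤n)) (q n (ℕ.m⊔n≤o⇒n≤o M N M⊔N≤n))

Eventually-map : ∀ {P Q : ℕ → Set} → (∀ n → P n → Q n) → Eventually P → Eventually Q
Eventually-map f (N , p) = N , λ n N≤n → f n (p n N≤n)

infix 8 -_
infixl 6 _-_
infixr 8 _^_

-_ : ℝ → ℝ
- x = mkℝ (λ n → ℚ.- seq x n) λ ε 0<ε →
  let N , p = cauchy x ε 0<ε in
  N , λ m n N≤m N≤n → subst (ℚ._< ε) (eq (seq x m) (seq x n)) (p m n N≤m N≤n)
  where
  eq : ∀ p q → ∣ p ℚ.- q ∣ ≡ ∣ ℚ.- p ℚ.- ℚ.- q ∣
  eq p q = trans (∣p-q∣-sym p q) (cong ∣_∣ (solve 2 (λ p q → q :- p := :- p :- :- q) refl p q))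

_-_ : ℝ → ℝ → ℝ
x - y = x + - y

_^_ : ℝ → ℕ → ℝ
x ^ zero  = 1ℝ
x ^ suc k = x * x ^ k

seq≤⇒≤ : (∀ n → seq x n ℚ.≤ seq y n) → x ≤ y
seq≤⇒≤ {x} {y} x≤y = mk≤ λ ε 0<ε → 0 , λ n _ →
  subst (ℚ._< seq y n ℚ.+ ε) (ℚ.+-identityʳ (seq x n)) (ℚ.+-mono-≤-< (x≤y n) 0<ε)

seq≡⇒≤ : (∀ n → seq x n ≡ seq y n) → x ≤ y
seq≡⇒≤ x≡y = seq≤⇒≤ λ n → ℚ.≤-reflexive (x≡y n)

≤-refl : x ≤ x
≤-refl = seq≡⇒≤ λ _ → refl

≤⇒0≤- : x ≤ y → 0ℝ ≤ y - x
≤⇒0≤- {x} {y} x≤y = mk≤ λ ε 0<ε → Eventually-map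
  (λ n lt → subst (0ℚ ℚ.<_) (solve 3 (λ x y ε → (y :+ ε) :- x := (y :- x) :+ ε) refl (seq x n) (seq y n) ε) (<⇒0< lt))
  (below x≤y ε 0<ε)

-- The usual route to an inequality below: `d` is assembled from nonnegative pieces, and the
-- termwise identity is left to the ring solver.
≤-by : ∀ {d} → 0ℝ ≤ d → (∀ n → seq y n ℚ.- seq x n ≡ seq d n) → x ≤ y
≤-by {y} {x} {d} 0≤d eq = mk≤ λ ε 0<ε → Eventually-map
  (λ n lt → 0<⇒< lt (trans (solve 3 (λ x y ε → (y :+ ε) :- x := (y :- x) :+ ε) refl (seq x n) (seq y n) ε)
    (cong (ℚ._+ ε) (eq n))))
  (below 0≤d ε 0<ε)

0≤-+ : 0ℝ ≤ x → 0ℝ ≤ y → 0ℝ ≤ x + y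
0≤-+ {x} {y} 0≤x 0≤y = mk≤ λ ε 0<ε → Eventually-map₂
  (λ n p q → subst (0ℚ ℚ.<_) (eq (seq x n) (seq y n) ε) (ℚ.+-mono-< p q))
  (below 0≤x _ (0<½* 0<ε)) (below 0≤y _ (0<½* 0<ε))
  where
  eq : ∀ p q ε → (p ℚ.+ ½ ℚ.* ε) ℚ.+ (q ℚ.+ ½ ℚ.* ε) ≡ (p ℚ.+ q) ℚ.+ ε
  eq p q ε = trans
    (solve 3 (λ p q h → (p :+ h) :+ (q :+ h) := (p :+ q) :+ (h :+ h)) refl p q (½ ℚ.* ε))
    (cong ((p ℚ.+ q) ℚ.+_) (½+½ ε))

bounded-above : ∀ x → ∃[ B ] (0ℚ ℚ.< B × Eventually λ n → seq x n ℚ.≤ B)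
bounded-above x with cauchy x 1ℚ (ℚ.positive⁻¹ 1ℚ)
... | N , p = ∣ seq x N ∣ ℚ.+ 1ℚ ,
  ℚ.+-mono-≤-< (ℚ.0≤∣p∣ (seq x N)) (ℚ.positive⁻¹ 1ℚ) ,
  N , λ n N≤n → ℚ.≤-trans (ℚ.<⇒≤ (∣p-q∣<ε⇒p<q+ε (p n N N≤n ℕ.≤-refl)))
    (ℚ.+-monoˡ-≤ 1ℚ (p≤∣p∣ (seq x N)))

-- The witness is the smaller of 1 and `ε` / `K`.
shrink : ∀ K ε → 0ℚ ℚ.< K → 0ℚ ℚ.< ε → ∃[ δ ] (0ℚ ℚ.< δ × δ ℚ.≤ 1ℚ × δ ℚ.* K ℚ.≤ ε)
shrink K ε 0<K 0<ε = pick (ℚ.≤-total 1ℚ q)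
  where
  instance K>0 = positive 0<K
  instance K≢0 = ℚ.pos⇒nonZero K
  q : ℚ
  q = ε ℚ.* ℚ.1/ K
  qK≡ε : q ℚ.* K ≡ ε
  qK≡ε = trans (ℚ.*-assoc ε (ℚ.1/ K) K)
    (trans (cong (ε ℚ.*_) (ℚ.*-inverseˡ K)) (ℚ.*-identityʳ ε))
  pick : 1ℚ ℚ.≤ q ⊎ q ℚ.≤ 1ℚ → ∃[ δ ] (0ℚ ℚ.< δ × δ ℚ.≤ 1ℚ × δ ℚ.* K ℚ.≤ ε)
  pick (inj₁ 1≤q) = 1ℚ , ℚ.positive⁻¹ 1ℚ , ℚ.≤-refl ,
    subst (1ℚ ℚ.* K ℚ.≤_) qK≡ε (ℚ.*-monoʳ-≤-nonNeg K {{ℚ.pos⇒nonNeg K}} 1≤q)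
  pick (inj₂ q≤1) = q , 0<p*q 0<ε (ℚ.positive⁻¹ (ℚ.1/ K) {{ℚ.1/pos⇒pos K}}) ,
    q≤1 , ℚ.≤-reflexive qK≡ε

-- If x ≤ B, y ≤ C and x, y > - δ with δ ≤ 1, then (x + δ)(y + δ) > 0 gives
-- xy > - δ (x + y + δ) ≥ - δ (B + C + 1).
0≤-* : 0ℝ ≤ x → 0ℝ ≤ y → 0ℝ ≤ x * y
0≤-* {x} {y} 0≤x 0≤y = mk≤ λ ε 0<ε →
  let B , 0<B , x≤B = bounded-above x
      C , 0<C , y≤C = bounded-above y
      δ , 0<δ , δ≤1 , δK≤ε = shrink (B ℚ.+ C ℚ.+ 1ℚ) ε
        (ℚ.+-mono-< (ℚ.+-mono-< 0<B 0<C) (ℚ.positive⁻¹ 1ℚ)) 0<ε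
  in Eventually-map₂ (λ n → λ where
       (x≤B , y≤C) (-δ<x , -δ<y) → subst (0ℚ ℚ.<_) (eq (seq x n) (seq y n) B C δ ε)
         (ℚ.+-mono-<-≤ (0<p*q -δ<x -δ<y) (ℚ.+-mono-≤ {0ℚ} {_} {0ℚ} (≤⇒0≤ δK≤ε)
           (0≤p*q (ℚ.<⇒≤ 0<δ) (ℚ.+-mono-≤ (ℚ.+-mono-≤ (≤⇒0≤ x≤B) (≤⇒0≤ y≤C)) (≤⇒0≤ δ≤1))))))
     (Eventually-map₂ (λ _ → _,_) x≤B y≤C)
     (Eventually-map₂ (λ _ → _,_) (below 0≤x δ 0<δ) (below 0≤y δ 0<δ))
  where
  eq : ∀ p q B C δ ε →
    (p ℚ.+ δ) ℚ.* (q ℚ.+ δ) ℚ.+ ((ε ℚ.- δ ℚ.* (B ℚ.+ C ℚ.+ 1ℚ))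
      ℚ.+ δ ℚ.* ((B ℚ.- p) ℚ.+ (C ℚ.- q) ℚ.+ (1ℚ ℚ.- δ))) ≡ p ℚ.* q ℚ.+ ε
  eq p q B C δ ε = solve 7 (λ p q B C δ ε o →
    (p :+ δ) :* (q :+ δ) :+ ((ε :- δ :* (B :+ C :+ o)) :+ δ :* ((B :- p) :+ (C :- q) :+ (o :- δ)))
    := p :* q :+ ε) refl p q B C δ ε 1ℚ

≤-trans : x ≤ y → y ≤ z → x ≤ z
≤-trans {x} {y} {z} x≤y y≤z = ≤-by (0≤-+ (≤⇒0≤- x≤y) (≤⇒0≤- y≤z))
  λ n → solve 3 (λ x y z → z :- x := (y :- x) :+ (z :- y)) refl (seq x n) (seq y n) (seq z n)

≃⇒≤ : x ≃ y → x ≤ y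
≃⇒≤ x≃y = mk≤ λ ε 0<ε → Eventually-map (λ n → ∣p-q∣<ε⇒p<q+ε) (close x≃y ε 0<ε)

≃-sym : x ≃ y → y ≃ x
≃-sym {x} {y} x≃y = mk≃ λ ε 0<ε →
  Eventually-map (λ n → subst (ℚ._< ε) (∣p-q∣-sym (seq x n) (seq y n))) (close x≃y ε 0<ε)

≤-antisym : x ≤ y → y ≤ x → x ≃ y
≤-antisym {x} {y} x≤y y≤x = mk≃ λ ε 0<ε →
  Eventually-map₂ (λ n → two-sided (seq x n) (seq y n) ε) (below x≤y ε 0<ε) (below y≤x ε 0<ε)
  where
  two-sided : ∀ p q ε → p ℚ.< q ℚ.+ ε → q ℚ.< p ℚ.+ ε → ∣ p ℚ.- q ∣ ℚ.< ε
  two-sided p q ε p<q+ε q<p+ε with ℚ.∣p∣≡p∨∣p∣≡-p (p ℚ.- q)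
  ... | inj₁ eq = subst (ℚ._< ε) (sym eq) (0<⇒< (<⇒0< p<q+ε)
        (solve 3 (λ p q ε → ε :- (p :- q) := q :+ ε :- p) refl p q ε))
  ... | inj₂ eq = subst (ℚ._< ε) (sym eq) (0<⇒< (<⇒0< q<p+ε)
        (solve 3 (λ p q ε → ε :- :- (p :- q) := p :+ ε :- q) refl p q ε))

-- Comparison with rationals and classical case distinction.

fromℚ-mono : ∀ {p q} → p ℚ.≤ q → fromℚ p ≤ fromℚ q
fromℚ-mono p≤q = seq≤⇒≤ λ _ → p≤q

fromℚ-cancel-≤ : ∀ {p q} → fromℚ p ≤ fromℚ q → p ℚ.≤ q
fromℚ-cancel-≤ {p} {q} p≤q = ℚ.≮⇒≥ λ q<p →
  let N , h = below p≤q (p ℚ.- q) (<⇒0< q<p)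
  in ℚ.<-irrefl (solve 2 (λ p q → p := q :+ (p :- q)) refl p q) (h N ℕ.≤-refl)

-- A single term within `η` of all later ones is compared with 2`η`. The two alternatives overlap,
-- which makes the choice constructive.
≤-approx : ∀ x η → 0ℚ ℚ.< η → x ≤ fromℚ (η ℚ.+ η ℚ.+ η) ⊎ fromℚ η ≤ x
≤-approx x η 0<η with cauchy x η 0<η
... | N , p with ℚ.≤-total (seq x N) (η ℚ.+ η)
... | inj₁ xN≤2η = inj₁ (mk≤ λ ε 0<ε → N , λ n N≤n →
        ℚ.<-≤-trans (∣p-q∣<ε⇒p<q+ε (p n N N≤n ℕ.≤-refl))
          (ℚ.≤-trans (ℚ.+-monoˡ-≤ η xN≤2η) (ℚ.<⇒≤ (0<⇒< 0<ε
            (solve 2 (λ h ε → h :+ ε :- h := ε) refl (η ℚ.+ η ℚ.+ η) ε)))))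
... | inj₂ 2η≤xN = inj₂ (mk≤ λ ε 0<ε → N , λ n N≤n → 0<⇒<
        (ℚ.+-mono-< (<⇒0< (ℚ.≤-<-trans 2η≤xN (∣p-q∣<ε⇒p<q+ε (p N n ℕ.≤-refl N≤n)))) 0<ε)
        (solve 3 (λ h x ε → x :+ ε :- h := x :+ h :- (h :+ h) :+ ε) refl η (seq x n) ε))

private
  ⅓ : ℚ
  ⅓ = + 1 ℚ./ 3

  ⅓+⅓+⅓ : ∀ ε → ⅓ ℚ.* ε ℚ.+ ⅓ ℚ.* ε ℚ.+ ⅓ ℚ.* ε ≡ ε
  ⅓+⅓+⅓ ε = trans (solve 2 (λ t e → t :* e :+ t :* e :+ t :* e := (t :+ t :+ t) :* e) refl ⅓ ε)
    (ℚ.*-identityˡ ε)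

-- With `h` = `ε` / 2 and tolerance `h` / 3, the second alternative of `≤-approx` is excluded and
-- the first gives `x` ≤ `h`, so eventually `x` stays below 2`h` = `ε`.
¬positive⇒≤0 : (∀ δ → 0ℚ ℚ.< δ → ¬ fromℚ δ ≤ x) → x ≤ 0ℝ
¬positive⇒≤0 {x} ¬pos = mk≤ λ ε 0<ε → approx (½ ℚ.* ε) (0<½* 0<ε) ε (½+½ ε)
  where
  approx : ∀ h → 0ℚ ℚ.< h → ∀ ε → h ℚ.+ h ≡ ε → Eventually λ n → seq x n ℚ.< 0ℚ ℚ.+ ε
  approx h 0<h ε refl with ≤-approx x (⅓ ℚ.* h) (0<p*q (ℚ.positive⁻¹ ⅓) 0<h)
  ... | inj₂ pos = ⊥-elim (¬pos _ (0<p*q (ℚ.positive⁻¹ ⅓) 0<h) pos)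
  ... | inj₁ x≤h = Eventually-map (λ n lt → subst (seq x n ℚ.<_)
        (trans (cong (ℚ._+ h) (⅓+⅓+⅓ h)) (sym (ℚ.+-identityˡ (h ℚ.+ h)))) lt)
        (below x≤h h 0<h)

≤-by-≤0 : ∀ {d} → d ≤ 0ℝ → (∀ n → seq x n ℚ.- seq y n ≡ seq d n) → x ≤ y
≤-by-≤0 {x} {y} {d} d≤0 eq = ≤-by (≤⇒0≤- d≤0) λ n → trans
  (solve 2 (λ x y → y :- x := con 0ℚ :- (x :- y)) refl (seq x n) (seq y n)) (cong (λ p → 0ℚ ℚ.- p) (eq n))

≤⇒-≤0 : x ≤ y → x - y ≤ 0ℝ
≤⇒-≤0 {x} {y} x≤y = ≤-by (≤⇒0≤- x≤y) λ n →
  solve 2 (λ x y → con 0ℚ :- (x :- y) := y :- x) refl (seq x n) (seq y n)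

positive-≰0 : ∀ {δ} → 0ℚ ℚ.< δ → ¬ fromℚ δ ≤ 0ℝ
positive-≰0 0<δ δ≤0 = ℚ.<-irrefl refl (ℚ.<-≤-trans 0<δ (fromℚ-cancel-≤ δ≤0))

-- By `¬positive⇒≤0` it suffices that no positive rational lies below `x - y`; this is a negation,
-- so a doubly negated hypothesis is enough.
≤-stable : ¬ ¬ x ≤ y → x ≤ y
≤-stable {x} {y} ¬¬x≤y = ≤-by-≤0 (¬positive⇒≤0 {x - y} λ δ 0<δ δ≤x-y →
  ¬¬x≤y λ x≤y → positive-≰0 0<δ (≤-trans δ≤x-y (≤⇒-≤0 x≤y))) λ _ → refl

-- Inequalities are ¬¬-stable, so proofs of them may use the classical dichotomy
-- between x ≤ 0 and x > 0.
≤0∨positive : ∀ x → (x ≤ 0ℝ → a ≤ b) → (∀ δ → 0ℚ ℚ.< δ → fromℚ δ ≤ x → a ≤ b) → a ≤ b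
≤0∨positive x nonpos pos = ≤-stable λ ¬a≤b →
  ¬a≤b (nonpos (¬positive⇒≤0 λ δ 0<δ δ≤x → ¬a≤b (pos δ 0<δ δ≤x)))

-- Cancellation and monotonicity for products and powers.

-- With `h` = `δ` / 2 the terms of `x` eventually exceed `h`, so a term of `y` at most -`ε` would
-- push the product below -`h` `ε`.
*-cancel-0≤ : ∀ {δ} → 0ℚ ℚ.< δ → fromℚ δ ≤ x → 0ℝ ≤ x * y → 0ℝ ≤ y
*-cancel-0≤ {x} {y} {δ} 0<δ δ≤x 0≤xy = mk≤ λ ε 0<ε → Eventually-map₂
  (λ n → bound-below (seq x n) (seq y n) (½ ℚ.* δ) ε (0<½* 0<δ) 0<ε)
  (Eventually-map (λ n lt → 0<⇒< (<⇒0< lt) (trans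
      (solve 2 (λ x h → x :- h := x :+ h :- (h :+ h)) refl (seq x n) (½ ℚ.* δ))
      (cong (λ p → seq x n ℚ.+ ½ ℚ.* δ ℚ.- p) (½+½ δ))))
    (below δ≤x (½ ℚ.* δ) (0<½* 0<δ)))
  (below 0≤xy (½ ℚ.* δ ℚ.* ε) (0<p*q (0<½* 0<δ) 0<ε))
  where
  bound-below : ∀ p q h ε → 0ℚ ℚ.< h → 0ℚ ℚ.< ε → h ℚ.< p → 0ℚ ℚ.< p ℚ.* q ℚ.+ h ℚ.* ε → 0ℚ ℚ.< q ℚ.+ ε
  bound-below p q h ε 0<h 0<ε h<p 0<pq+hε = ℚ.≰⇒> λ q+ε≤0 → ℚ.<-irrefl refl
    (subst (0ℚ ℚ.<_)
      (solve 4 (λ p q h ε → p :* q :+ h :* ε :+ (p :- h) :* ε :+ p :* (con 0ℚ :- (q :+ ε))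
        := con 0ℚ) refl p q h ε)
      (ℚ.+-mono-<-≤ (ℚ.+-mono-< 0<pq+hε (0<p*q (<⇒0< h<p) 0<ε)) (0≤p*q (ℚ.<⇒≤ (ℚ.<-trans 0<h h<p)) (≤⇒0≤ q+ε≤0))))

*-cancel-≤ : ∀ {δ} → 0ℚ ℚ.< δ → fromℚ δ ≤ x → x * y ≤ x * z → y ≤ z
*-cancel-≤ {x} {y} {z} 0<δ δ≤x xy≤xz = ≤-by
  (*-cancel-0≤ {x} {z - y} 0<δ δ≤x (≤-by (≤⇒0≤- xy≤xz) λ n →
    solve 3 (λ x y z → x :* (z :- y) :- con 0ℚ := x :* z :- x :* y) refl (seq x n) (seq y n) (seq z n)))
  λ _ → refl

*-mono-≤ : 0ℝ ≤ x → 0ℝ ≤ z → x ≤ y → z ≤ a → x * z ≤ y * a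
*-mono-≤ {x} {z} {y} {a} 0≤x 0≤z x≤y z≤a = ≤-by
  (0≤-+ (0≤-* (≤⇒0≤- x≤y) (≤-trans 0≤z z≤a)) (0≤-* 0≤x (≤⇒0≤- z≤a)))
  λ n → solve 4 (λ x y z a → y :* a :- x :* z := (y :- x) :* a :+ x :* (a :- z)) refl
    (seq x n) (seq y n) (seq z n) (seq a n)

*-monoˡ-≤ : 0ℝ ≤ x → y ≤ z → x * y ≤ x * z
*-monoˡ-≤ {x} {y} {z} 0≤x y≤z = ≤-by (0≤-* 0≤x (≤⇒0≤- y≤z))
  λ n → solve 3 (λ x y z → x :* z :- x :* y := x :* (z :- y)) refl (seq x n) (seq y n) (seq z n)

0≤1 : 0ℝ ≤ 1ℝ
0≤1 = fromℚ-mono (ℚ.nonNegative⁻¹ 1ℚ)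

0≤-^ : ∀ k → 0ℝ ≤ x → 0ℝ ≤ x ^ k
0≤-^ zero    0≤x = 0≤1
0≤-^ (suc k) 0≤x = 0≤-* 0≤x (0≤-^ k 0≤x)

^-mono-≤ : ∀ k → 0ℝ ≤ x → x ≤ y → x ^ k ≤ y ^ k
^-mono-≤ zero    0≤x x≤y = ≤-refl
^-mono-≤ (suc k) 0≤x x≤y = *-mono-≤ 0≤x (0≤-^ k 0≤x) x≤y (^-mono-≤ k 0≤x x≤y)

^-cancel-≤ : ∀ {δ} k → 0ℚ ℚ.< δ → fromℚ δ ≤ x → x ^ k * y ≤ x ^ k * z → y ≤ z
^-cancel-≤ {x} {y} {z} zero    0<δ δ≤x le = ≤-by (≤⇒0≤- le)
  λ n → solve 2 (λ y z → z :- y := con 1ℚ :* z :- con 1ℚ :* y) refl (seq y n) (seq z n)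
^-cancel-≤ {x} {y} {z} (suc k) 0<δ δ≤x le = ^-cancel-≤ k 0<δ δ≤x (*-cancel-≤ 0<δ δ≤x
  (≤-by (≤⇒0≤- le) λ n →
    solve 4 (λ x w y z → x :* (w :* z) :- x :* (w :* y) := x :* w :* z :- x :* w :* y) refl
      (seq x n) (seq (x ^ k) n) (seq y n) (seq z n)))

-- If `x` exceeded `y`, then `x ^ k * x` ≤ `y * y ^ k` ≤ `x ^ k * y`, and the positive factor
-- `x ^ k` could be cancelled.
^-reflects-≤ : ∀ k → 0ℝ ≤ y → x ^ suc k ≤ y ^ suc k → x ≤ y
^-reflects-≤ {y} {x} k 0≤y le = ≤0∨positive (x - y) (λ x-y≤0 → ≤-by-≤0 x-y≤0 λ _ → refl)
  λ δ 0<δ δ≤x-y →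
    let 0≤x-y = ≤-trans (fromℚ-mono (ℚ.<⇒≤ 0<δ)) δ≤x-y
        y≤x = ≤-by 0≤x-y λ _ → refl
        δ≤x = ≤-trans δ≤x-y (≤-by 0≤y λ n →
          solve 2 (λ x y → x :- (x :- y) := y) refl (seq x n) (seq y n))
    in ^-cancel-≤ k 0<δ δ≤x (≤-trans
         (≤-by {y = y * y ^ k} (≤⇒0≤- le) λ n →
           solve 3 (λ x w v → v :- w :* x := v :- x :* w) refl (seq x n) (seq (x ^ k) n) (seq (y ^ suc k) n))
         (≤-by (0≤-* 0≤y (≤⇒0≤- (^-mono-≤ k 0≤y y≤x))) λ n →
           solve 3 (λ w y v → w :* y :- y :* v := y :* (w :- v)) refl (seq (x ^ k) n) (seq y n) (seq (y ^ k) n)))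

square≤0⇒≤ : (x - y) * (x - y) ≤ 0ℝ → x ≤ y
square≤0⇒≤ {x} {y} le = ≤0∨positive (x - y) (λ x-y≤0 → ≤-by-≤0 x-y≤0 λ _ → refl)
  λ δ 0<δ δ≤x-y → ≤-by-≤0 (*-cancel-≤ {y = x - y} {z = 0ℝ} 0<δ δ≤x-y (≤-by (≤⇒0≤- le) λ n →
    solve 1 (λ d → d :* con 0ℚ :- d :* d := con 0ℚ :- d :* d) refl (seq x n ℚ.- seq y n))) λ _ → refl

0≤square : ∀ x → 0ℝ ≤ x * x
0≤square x = seq≤⇒≤ λ n → square (seq x n)
  where
  square : ∀ p → 0ℚ ℚ.≤ p ℚ.* p
  square p with ℚ.≤-total 0ℚ p
  ... | inj₁ 0≤p = 0≤p*q 0≤p 0≤p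
  ... | inj₂ p≤0 = subst (0ℚ ℚ.≤_) (solve 1 (λ p → (con 0ℚ :- p) :* (con 0ℚ :- p) := p :* p) refl p)
        (0≤p*q (≤⇒0≤ p≤0) (≤⇒0≤ p≤0))

-- Natural numbers and their reciprocals as rationals.

-- Defined by recursion so that `ι (suc n)` unfolds to 1 + `ι n` inside ring identities; `toℚᵘ-ι`
-- links it to library fractions.
ι : ℕ → ℚ
ι zero    = 0ℚ
ι (suc n) = 1ℚ ℚ.+ ι n

0≤ι : ∀ n → 0ℚ ℚ.≤ ι n
0≤ι zero    = ℚ.≤-refl
0≤ι (suc n) = ℚ.+-mono-≤ {0ℚ} {1ℚ} {0ℚ} (ℚ.nonNegative⁻¹ 1ℚ) (0≤ι n)

0<ι : ∀ n .{{_ : ℕ.NonZero n}} → 0ℚ ℚ.< ι n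
0<ι (suc n) = ℚ.+-mono-<-≤ (ℚ.positive⁻¹ 1ℚ) (0≤ι n)

ιᴿ : ℕ → ℝ
ιᴿ n = fromℚ (ι n)

0≤ιᴿ : ∀ n → 0ℝ ≤ ιᴿ n
0≤ιᴿ n = fromℚ-mono (0≤ι n)

ι-+ : ∀ m n → ι (m ℕ.+ n) ≡ ι m ℚ.+ ι n
ι-+ zero    n = sym (ℚ.+-identityˡ (ι n))
ι-+ (suc m) n = trans (cong (1ℚ ℚ.+_) (ι-+ m n)) (sym (ℚ.+-assoc 1ℚ (ι m) (ι n)))

ι-* : ∀ m n → ι (m ℕ.* n) ≡ ι m ℚ.* ι n
ι-* zero    n = sym (ℚ.*-zeroˡ (ι n))
ι-* (suc m) n = trans (ι-+ n (m ℕ.* n)) (trans (cong (ι n ℚ.+_) (ι-* m n))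
  (solve 2 (λ m n → n :+ m :* n := (con 1ℚ :+ m) :* n) refl (ι m) (ι n)))

toℚᵘ-ι : ∀ n → ℚ.toℚᵘ (ι n) ℚᵘ.≃ mkℚᵘ (+ n) 0
toℚᵘ-ι zero    = ℚᵘ.≃-refl
toℚᵘ-ι (suc n) = ℚᵘ.≃-trans (ℚ.toℚᵘ-homo-+ 1ℚ (ι n))
  (ℚᵘ.≃-trans (ℚᵘ.+-congʳ ℚᵘ.1ℚᵘ (toℚᵘ-ι n))
    (*≡* (cong (λ m → (1ℤ ℤ.+ m) ℤ.* 1ℤ) (ℤ.*-identityʳ (+ n)))))

recip : ∀ n .{{_ : ℕ.NonZero n}} → ℚ
recip n = 1ℤ ℚ./ n

ι-*-recip : ∀ n .{{_ : ℕ.NonZero n}} → ι n ℚ.* recip n ≡ 1ℚ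
ι-*-recip (suc n) = ℚ.toℚᵘ-injective (ℚᵘ.≃-trans (ℚ.toℚᵘ-homo-* (ι (suc n)) (recip (suc n)))
  (ℚᵘ.≃-trans (ℚᵘ.*-cong (toℚᵘ-ι (suc n)) (ℚ.toℚᵘ-fromℚᵘ (mkℚᵘ 1ℤ n)))
    (*≡* (trans (ℤ.*-identityʳ _) (trans (ℤ.*-identityʳ (+ suc n))
      (sym (trans (ℤ.*-identityˡ _) (ℤ.*-identityˡ (+ suc n)))))))))

0<recip : ∀ n .{{_ : ℕ.NonZero n}} → 0ℚ ℚ.< recip n
0<recip n = ℚ.positive⁻¹ (recip n) {{ℚ.normalize-pos 1 n}}

recip-* : ∀ m n .{{_ : ℕ.NonZero m}} .{{_ : ℕ.NonZero n}} .{{_ : ℕ.NonZero (m ℕ.* n)}} →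
  recip (m ℕ.* n) ≡ recip m ℚ.* recip n
recip-* m n = begin
  r                                       ≡⟨ solve 1 (λ r → r := con 1ℚ :* con 1ℚ :* r) refl r ⟩
  1ℚ ℚ.* 1ℚ ℚ.* r                         ≡⟨ cong₂ (λ u v → u ℚ.* v ℚ.* r) (ι-*-recip m) (ι-*-recip n) ⟨
  ι m ℚ.* p ℚ.* (ι n ℚ.* q) ℚ.* r         ≡⟨ solve 5 (λ m n p q r → m :* p :* (n :* q) :* r := p :* q :* (m :* n :* r)) refl (ι m) (ι n) p q r ⟩
  p ℚ.* q ℚ.* (ι m ℚ.* ι n ℚ.* r)         ≡⟨ cong (λ u → p ℚ.* q ℚ.* (u ℚ.* r)) (ι-* m n) ⟨
  p ℚ.* q ℚ.* (ι (m ℕ.* n) ℚ.* r)         ≡⟨ cong (p ℚ.* q ℚ.*_) (ι-*-recip (m ℕ.* n)) ⟩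
  p ℚ.* q ℚ.* 1ℚ                          ≡⟨ ℚ.*-identityʳ (p ℚ.* q) ⟩
  p ℚ.* q                                 ∎
  where
  open ≡-Reasoning
  p = recip m
  q = recip n
  r = recip (m ℕ.* n)

ι-*-recip-* : ∀ m n .{{_ : ℕ.NonZero m}} .{{_ : ℕ.NonZero n}} .{{_ : ℕ.NonZero (m ℕ.* n)}} →
  ι m ℚ.* recip (m ℕ.* n) ≡ recip n
ι-*-recip-* m n = trans (cong (ι m ℚ.*_) (recip-* m n)) (trans (sym (ℚ.*-assoc (ι m) (recip m) (recip n)))
  (trans (cong (ℚ._* recip n) (ι-*-recip m)) (ℚ.*-identityˡ (recip n))))

-- Bernoulli's inequality and the AM-GM step.

mutual
  -- With t = `c` / `a` this is 1 + (k + 1)(t - 1) ≤ t^(k + 1), multiplied through by `a ^ suc k` so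
  -- that `a` = 0 is allowed.
  bernoulli : ∀ k → 0ℝ ≤ a → 0ℝ ≤ c →
    ιᴿ (suc k) * c * a ^ k ≤ c ^ suc k + ιᴿ k * a ^ suc k
  bernoulli {a} {c} zero    0≤a 0≤c = seq≡⇒≤ λ n →
    solve 2 (λ a c → (con 1ℚ :+ con 0ℚ) :* c :* con 1ℚ := c :* con 1ℚ :+ con 0ℚ :* (a :* con 1ℚ)) refl
      (seq a n) (seq c n)
  bernoulli {a} {c} (suc k) 0≤a 0≤c = ≤-trans
    (≤-by {d = ιᴿ (suc k) * a ^ k * ((c - a) * (c - a))}
      (0≤-* (0≤-* (0≤ιᴿ (suc k)) (0≤-^ k 0≤a)) (0≤square (c - a)))
      λ n → solve 2 (λ x y → x :+ y :- x := y) refl (seq (ιᴿ (suc (suc k)) * c * a ^ suc k) n) _)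
    (bernoulli-strict k 0≤a 0≤c)

  -- Once the square term is subtracted, the defect for `suc k` is exactly `c` times the defect of
  -- `bernoulli` for `k`. The square is kept for the equality case.
  bernoulli-strict : ∀ k → 0ℝ ≤ a → 0ℝ ≤ c →
    ιᴿ (suc (suc k)) * c * a ^ suc k + ιᴿ (suc k) * a ^ k * ((c - a) * (c - a)) ≤
    c ^ suc (suc k) + ιᴿ (suc k) * a ^ suc (suc k)
  bernoulli-strict {a} {c} k 0≤a 0≤c = ≤-by (0≤-* 0≤c (≤⇒0≤- (bernoulli k 0≤a 0≤c))) λ n →
    solve 5 (λ a c u v m →
      c :* (c :* v) :+ (con 1ℚ :+ m) :* (a :* (a :* u)) :- ((con 1ℚ :+ (con 1ℚ :+ m)) :* c :* (a :* u)
        :+ (con 1ℚ :+ m) :* u :* ((c :- a) :* (c :- a)))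
      := c :* (c :* v :+ m :* (a :* u) :- (con 1ℚ :+ m) :* c :* u)) refl
      (seq a n) (seq c n) (seq (a ^ k) n) (seq (c ^ k) n) (ι k)

^-distrib-* : ∀ x y k n → seq ((x * y) ^ k) n ≡ seq (x ^ k) n ℚ.* seq (y ^ k) n
^-distrib-* x y zero    n = sym (ℚ.*-identityˡ 1ℚ)
^-distrib-* x y (suc k) n = trans (cong (seq x n ℚ.* seq y n ℚ.*_) (^-distrib-* x y k n))
  (solve 4 (λ x y u v → x :* y :* (u :* v) := x :* u :* (y :* v)) refl
    (seq x n) (seq y n) (seq (x ^ k) n) (seq (y ^ k) n))

+-monoˡ-≤ : x ≤ y → x + z ≤ y + z
+-monoˡ-≤ {x} {y} {z} x≤y = ≤-by (≤⇒0≤- x≤y) λ n →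
  solve 3 (λ x y z → y :+ z :- (x :+ z) := y :- x) refl (seq x n) (seq y n) (seq z n)

-- For g ≥ 0 the ratio x / (x + g) is nondecreasing in x.
^-rescale : ∀ {x′ q g} k → 0ℝ ≤ x′ → x′ ≤ x → 0ℝ ≤ g → 0ℝ ≤ q →
  x ^ k ≤ q * (x + g) ^ k → x′ ^ k ≤ q * (x′ + g) ^ k
^-rescale {x} {x′} {q} {g} k 0≤x′ x′≤x 0≤g 0≤q h = ≤0∨positive x
  (λ x≤0 → ≤-trans (^-mono-≤ k 0≤x′ x′≤x) (≤-trans h
    (*-monoˡ-≤ 0≤q (^-mono-≤ k (0≤-+ (≤-trans 0≤x′ x′≤x) 0≤g) (+-monoˡ-≤ (≤-trans x≤0 0≤x′))))))
  λ δ 0<δ δ≤x → ^-cancel-≤ k 0<δ δ≤x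
    (≤-trans (seq≡⇒≤ λ n → ℚ.*-comm (seq (x ^ k) n) (seq (x′ ^ k) n))
    (≤-trans (*-monoˡ-≤ (0≤-^ k 0≤x′) h)
    (≤-trans (seq≡⇒≤ {y = q * (x′ * (x + g)) ^ k} λ n → trans
      (solve 3 (λ u q v → u :* (q :* v) := q :* (u :* v)) refl
        (seq (x′ ^ k) n) (seq q n) (seq ((x + g) ^ k) n))
      (cong (seq q n ℚ.*_) (sym (^-distrib-* x′ (x + g) k n))))
    (≤-trans (*-monoˡ-≤ 0≤q (^-mono-≤ {y = x * (x′ + g)} k (0≤-* 0≤x′ (0≤-+ (≤-trans 0≤x′ x′≤x) 0≤g))
      (≤-by (0≤-* (≤⇒0≤- x′≤x) 0≤g) λ n →
        solve 3 (λ x x′ g → x :* (x′ :+ g) :- x′ :* (x :+ g) := (x :- x′) :* g) refl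
          (seq x n) (seq x′ n) (seq g n))))
    (seq≡⇒≤ λ n → trans (cong (seq q n ℚ.*_) (^-distrib-* x (x′ + g) k n))
      (solve 3 (λ u q v → q :* (u :* v) := u :* (q :* v)) refl
        (seq (x ^ k) n) (seq q n) (seq ((x′ + g) ^ k) n)))))))

-- When c is the mean of y and k copies of a, Bernoulli's inequality is the step
-- from k to k + 1 of the AM–GM inequality.
IsMean : ℕ → ℝ → ℚ → ℝ → Set
IsMean k a y c = ∀ n → ι (suc k) ℚ.* seq c n ≡ ι k ℚ.* seq a n ℚ.+ y

0≤mean : ∀ {y} k → IsMean k a y c → 0ℝ ≤ a → 0ℚ ℚ.≤ y → 0ℝ ≤ c
0≤mean {a} {c} {y} k mean 0≤a 0≤y = *-cancel-0≤ {ιᴿ (suc k)} (0<ι (suc k)) ≤-refl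
  (≤-by (0≤-+ (0≤-* (0≤ιᴿ k) 0≤a) (fromℚ-mono 0≤y)) λ n →
    trans (solve 1 (λ p → p :- con 0ℚ := p) refl (ι (suc k) ℚ.* seq c n)) (mean n))

mean⇒≡ : ∀ {y} k → IsMean k a y c → ∀ n → y ≡ ι (suc k) ℚ.* seq c n ℚ.- ι k ℚ.* seq a n
mean⇒≡ {a} {c} {y} k mean n = trans (solve 2 (λ p y → y := p :+ y :- p) refl (ι k ℚ.* seq a n) y)
  (cong (λ p → p ℚ.- ι k ℚ.* seq a n) (sym (mean n)))

am-gm : ∀ {y} k → IsMean k a y c → 0ℝ ≤ a → 0ℝ ≤ c → fromℚ y * a ^ k ≤ c ^ suc k
am-gm {a} {c} k mean 0≤a 0≤c = ≤-by (≤⇒0≤- (bernoulli k 0≤a 0≤c)) λ n → trans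
  (cong (λ p → seq (c ^ suc k) n ℚ.- p ℚ.* seq (a ^ k) n) (mean⇒≡ {a} {c} k mean n))
  (solve 5 (λ v m c a u → v :- ((con 1ℚ :+ m) :* c :- m :* a) :* u :=
    v :+ m :* (a :* u) :- (con 1ℚ :+ m) :* c :* u) refl
    (seq (c ^ suc k) n) (ι k) (seq c n) (seq a n) (seq (a ^ k) n))

am-gm-strict : ∀ {y} k → IsMean (suc k) a y c → 0ℝ ≤ a → 0ℝ ≤ c →
  fromℚ y * a ^ suc k + ιᴿ (suc k) * a ^ k * ((c - a) * (c - a)) ≤ c ^ suc (suc k)
am-gm-strict {a} {c} k mean 0≤a 0≤c = ≤-by (≤⇒0≤- (bernoulli-strict k 0≤a 0≤c)) λ n → trans
  (cong (λ p → seq (c ^ suc (suc k)) n ℚ.- (p ℚ.* seq (a ^ suc k) n ℚ.+ _)) (mean⇒≡ {a} {c} (suc k) mean n))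
  (solve 6 (λ v m c a u e → v :- (((con 1ℚ :+ m) :* c :- m :* a) :* u :+ e) :=
    v :+ m :* (a :* u) :- ((con 1ℚ :+ m) :* c :* u :+ e)) refl
    (seq (c ^ suc (suc k)) n) (ι (suc k)) (seq c n) (seq a n) (seq (a ^ suc k) n)
    (seq (ιᴿ (suc k) * a ^ k * ((c - a) * (c - a))) n))

-- Against `am-gm-strict`, the reversed inequality leaves `q` times the square term at most 0. Since
-- `q` and `a` are bounded away from 0, all factors but (c - a)² cancel.
am-gm-equality : ∀ {q δ y} k → IsMean (suc k) a y c → 0ℝ ≤ a → 0ℝ ≤ c →
  1ℝ ≤ q → 0ℚ ℚ.< δ → fromℚ δ ≤ a →
  q * c ^ suc (suc k) ≤ q * (fromℚ y * a ^ suc k) → a ≤ c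
am-gm-equality {a} {c} {q} {δ} {y} k mean 0≤a 0≤c 1≤q 0<δ δ≤a le =
  square≤0⇒≤ (≤-trans (seq≡⇒≤ {y = (c - a) * (c - a)} λ n →
    solve 2 (λ a c → (a :- c) :* (a :- c) := (c :- a) :* (c :- a)) refl (seq a n) (seq c n))
  (^-cancel-≤ k 0<δ δ≤a
  (*-cancel-≤ {ιᴿ (suc k)} (0<ι (suc k)) ≤-refl
    (≤-trans (seq≡⇒≤ {y = ιᴿ (suc k) * a ^ k * ((c - a) * (c - a))} λ n →
      sym (ℚ.*-assoc (ι (suc k)) (seq (a ^ k) n) (seq ((c - a) * (c - a)) n)))
    (≤-trans (excess≤0 (am-gm-strict k mean 0≤a 0≤c))
    (seq≡⇒≤ λ n → solve 2 (λ m u → con 0ℚ := m :* (u :* con 0ℚ)) refl (ι (suc k)) (seq (a ^ k) n)))))))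
  where
  excess≤0 : ∀ {w} → fromℚ y * a ^ suc k + w ≤ c ^ suc (suc k) → w ≤ 0ℝ
  excess≤0 {w} u+w≤v = *-cancel-≤ {q} (ℚ.positive⁻¹ 1ℚ) 1≤q (excess (≤-trans 0≤1 1≤q) u+w≤v le)
    where
    excess : ∀ {u v} → 0ℝ ≤ q → u + w ≤ v → q * v ≤ q * u → q * w ≤ q * 0ℝ
    excess {u} {v} 0≤q u+w≤v qv≤qu = ≤-by (0≤-+ (0≤-* 0≤q (≤⇒0≤- u+w≤v)) (≤⇒0≤- qv≤qu)) λ n →
      solve 4 (λ q u v w → q :* con 0ℚ :- q :* w := q :* (v :- (u :+ w)) :+ (q :* u :- q :* v)) refl
        (seq q n) (seq u n) (seq v n) (seq w n)

-- Induction on partial sums and partial products.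

-- Abstracts from the Sylvester sequence: `y` stands for the reciprocals 1/s, `σ` for the terms s
-- and `C` for their partial products.
module Majorisation
  (N : ℕ) (X : ℕ → ℝ) (σ y C : ℕ → ℚ)
  (0<y : ∀ k → 0ℚ ℚ.< y k) (0≤σ : ∀ k → 0ℚ ℚ.≤ σ k) (0≤C : ∀ k → 0ℚ ℚ.≤ C k)
  (σy≡1 : ∀ k → σ k ℚ.* y k ≡ 1ℚ)
  (0≤X : ∀ k → k ℕ.< N → 0ℝ ≤ X k)
  (X-dec : ∀ k → suc k ℕ.< N → X (suc k) ≤ X k)
  where

  G Q g : ℕ → ℝ
  G zero    = 0ℝ
  G (suc k) = G k + (fromℚ (y k) - X k)

  Q zero    = 1ℝ
  Q (suc k) = Q k * (fromℚ (σ k) * X k)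

  -- `g k` is `G k` / `k`; the default 0 at `k` = 0 keeps `ιg≡G` true there.
  g zero    = 0ℝ
  g (suc k) = fromℚ (recip (suc k)) * G (suc k)

  ιg≡G : ∀ k n → ι k ℚ.* seq (g k) n ≡ seq (G k) n
  ιg≡G zero    n = ℚ.*-zeroˡ 0ℚ
  ιg≡G (suc k) n = trans (sym (ℚ.*-assoc (ι (suc k)) (recip (suc k)) (seq (G (suc k)) n)))
    (trans (cong (ℚ._* seq (G (suc k)) n) (ι-*-recip (suc k))) (ℚ.*-identityˡ (seq (G (suc k)) n)))

  0≤Q : ∀ k → k ℕ.≤ N → 0ℝ ≤ Q k
  0≤Q zero    _   = 0≤1
  0≤Q (suc k) k<N = 0≤-* (0≤Q k (ℕ.<⇒≤ k<N)) (0≤-* (fromℚ-mono (0≤σ k)) (0≤X k k<N))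

  0≤G⇒0≤g : ∀ k → 0ℝ ≤ G k → 0ℝ ≤ g k
  0≤G⇒0≤g zero    _   = ≤-refl
  0≤G⇒0≤g (suc k) 0≤G = 0≤-* (fromℚ-mono (ℚ.<⇒≤ (0<recip (suc k)))) 0≤G

  0≤g⇒0≤G : ∀ k → 0ℝ ≤ g k → 0ℝ ≤ G k
  0≤g⇒0≤G k 0≤g = ≤-trans (0≤-* (0≤ιᴿ k) 0≤g) (seq≡⇒≤ (ιg≡G k))

  mean : ∀ k → IsMean k (X k + g k) (y k) (X k + g (suc k))
  mean k n = trans (ℚ.*-distribˡ-+ (1ℚ ℚ.+ ι k) (seq (X k) n) (seq (g (suc k)) n))
    (trans (cong ((1ℚ ℚ.+ ι k) ℚ.* seq (X k) n ℚ.+_) (trans (ιg≡G (suc k) n)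
      (cong (ℚ._+ (y k ℚ.- seq (X k) n)) (sym (ιg≡G k n)))))
    (solve 4 (λ m x g y → (con 1ℚ :+ m) :* x :+ (m :* g :+ (y :- x)) := m :* (x :+ g) :+ y) refl
      (ι k) (seq (X k) n) (seq (g k) n) (y k)))

  -- The step at the fixed entry `X k`: `aₖ` is shifted by the old average of `G`, `cₖ` by the new
  -- one, and `mean` relates the two.
  module Step (k : ℕ) (k<N : k ℕ.< N) (0≤G : 0ℝ ≤ G k)
    (inv : X k ^ k ≤ Q k * (X k + g k) ^ k) where

    xₖ qₖ aₖ cₖ : ℝ
    xₖ = X k
    qₖ = Q (suc k)
    aₖ = xₖ + g k
    cₖ = xₖ + g (suc k)

    0≤x = 0≤X k k<N
    0≤q = 0≤Q (suc k) k<N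

    x≤a : xₖ ≤ aₖ
    x≤a = ≤-by (0≤G⇒0≤g k 0≤G) λ n → solve 2 (λ x g → x :+ g :- x := g) refl (seq xₖ n) (seq (g k) n)

    0≤a : 0ℝ ≤ aₖ
    0≤a = ≤-trans 0≤x x≤a

    0≤c : 0ℝ ≤ cₖ
    0≤c = 0≤mean k (mean k) 0≤a (ℚ.<⇒≤ (0<y k))

    -- Multiplying `inv` by `xₖ` and inserting 1 = `σ k` `y k` turns `Q k` `xₖ` into `qₖ` `y k`.
    x^≤qya^ : xₖ ^ suc k ≤ qₖ * (fromℚ (y k) * aₖ ^ k)
    x^≤qya^ = ≤-trans (*-monoˡ-≤ 0≤x inv) (seq≡⇒≤ λ n → trans
      (solve 3 (λ x q u → x :* (q :* u) := con 1ℚ :* (x :* (q :* u))) refl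
        (seq xₖ n) (seq (Q k) n) (seq (aₖ ^ k) n))
      (trans (cong (ℚ._* (seq xₖ n ℚ.* (seq (Q k) n ℚ.* seq (aₖ ^ k) n))) (sym (σy≡1 k)))
      (solve 5 (λ s y x q u → s :* y :* (x :* (q :* u)) := q :* (s :* x) :* (y :* u)) refl
        (σ k) (y k) (seq xₖ n) (seq (Q k) n) (seq (aₖ ^ k) n))))

    inv′ : xₖ ^ suc k ≤ qₖ * cₖ ^ suc k
    inv′ = ≤-trans x^≤qya^ (*-monoˡ-≤ 0≤q (am-gm k (mean k) 0≤a 0≤c))

    G≤0⇒c≤x : G (suc k) ≤ 0ℝ → cₖ ≤ xₖ
    G≤0⇒c≤x G≤0 = ≤-by (0≤-* {fromℚ (recip (suc k))}
        (fromℚ-mono (ℚ.<⇒≤ (0<recip (suc k)))) (≤⇒0≤- G≤0))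
      λ n → solve 3 (λ x r G → x :- (x :+ r :* G) := r :* (con 0ℚ :- G)) refl
        (seq xₖ n) (recip (suc k)) (seq (G (suc k)) n)

    q≤1⇒q*≤ : ∀ z → 0ℝ ≤ z → qₖ ≤ 1ℝ → qₖ * z ≤ z
    q≤1⇒q*≤ z 0≤z q≤1 = ≤-by (0≤-* (≤⇒0≤- q≤1) 0≤z) λ n →
      solve 2 (λ q z → z :- q :* z := (con 1ℚ :- q) :* z) refl (seq qₖ n) (seq z n)

    module _ (Q≤ : qₖ ≤ 1ℝ + fromℚ (C (suc k)) * G (suc k)) where

      G≤0⇒q≤1 : G (suc k) ≤ 0ℝ → qₖ ≤ 1ℝ
      G≤0⇒q≤1 G≤0 = ≤-trans Q≤ (≤-by (0≤-* (fromℚ-mono (0≤C (suc k))) (≤⇒0≤- G≤0)) λ n →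
        solve 2 (λ C G → con 1ℚ :- (con 1ℚ :+ C :* G) := C :* (con 0ℚ :- G)) refl
          (C (suc k)) (seq (G (suc k)) n))

      -- If `G (suc k)` ≤ 0, then `qₖ` ≤ 1 and `inv′` gives `xₖ` ≤ `cₖ` after taking roots, which
      -- says that `g (suc k)` is nonnegative.
      0≤G′ : 0ℝ ≤ G (suc k)
      0≤G′ = ≤0∨positive (G (suc k))
        (λ G≤0 → 0≤g⇒0≤G (suc k) (≤-by
          (≤⇒0≤- (^-reflects-≤ k 0≤c (≤-trans inv′ (q≤1⇒q*≤ (cₖ ^ suc k) (0≤-^ (suc k) 0≤c) (G≤0⇒q≤1 G≤0)))))
          λ n → solve 2 (λ x g → g :- con 0ℚ := x :+ g :- x) refl (seq xₖ n) (seq (g (suc k)) n)))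
        λ δ 0<δ δ≤G → ≤-trans (fromℚ-mono (ℚ.<⇒≤ 0<δ)) δ≤G

      module _ (G≤0 : G (suc k) ≤ 0ℝ) where

        -- Otherwise `G (suc k)` would be at least `y k`, which is positive.
        x≤0⇒⊥ : ¬ xₖ ≤ 0ℝ
        x≤0⇒⊥ x≤0 = positive-≰0 (0<y k) (≤-by
          (0≤-+ (0≤-+ (≤⇒0≤- G≤0) 0≤G) (≤⇒0≤- x≤0)) λ n →
          solve 3 (λ y G x → con 0ℚ :- y := con 0ℚ :- (G :+ (y :- x)) :+ G :+ (con 0ℚ :- x)) refl
            (y k) (seq (G k) n) (seq xₖ n))

        -- Here `cₖ` ≤ `xₖ`, so `inv′` bounds `xₖ ^ suc k` by `qₖ` times itself.
        1≤q : ∀ {δ} → 0ℚ ℚ.< δ → fromℚ δ ≤ xₖ → 1ℝ ≤ qₖ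
        1≤q 0<δ δ≤x = ^-cancel-≤ {x = xₖ} (suc k) 0<δ δ≤x
          (≤-trans (seq≡⇒≤ λ n → ℚ.*-identityʳ (seq (xₖ ^ suc k) n))
          (≤-trans inv′ (≤-trans (*-monoˡ-≤ 0≤q (^-mono-≤ (suc k) 0≤c (G≤0⇒c≤x G≤0)))
            (seq≡⇒≤ λ n → ℚ.*-comm (seq qₖ n) (seq (xₖ ^ suc k) n)))))

  module _ (Q≤ : ∀ k → suc k ℕ.< N → Q (suc k) ≤ 1ℝ + fromℚ (C (suc k)) * G (suc k)) where

    -- Both claims advance together: the power inequality yields `G (suc k)` ≥ 0, and this sign is
    -- what lets `^-rescale` pass from `X k` to the smaller `X (suc k)`.
    invariant : ∀ k → k ℕ.< N → 0ℝ ≤ G k × X k ^ k ≤ Q k * (X k + g k) ^ k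
    invariant zero    _     = ≤-refl , seq≡⇒≤ λ _ → sym (ℚ.*-identityˡ 1ℚ)
    invariant (suc k) 1+k<N =
      let k<N = ℕ.<⇒≤ 1+k<N
          0≤G , inv = invariant k k<N
          open Step k k<N 0≤G inv
          0≤G⁺ = 0≤G′ (Q≤ k 1+k<N)
      in 0≤G⁺ , ^-rescale (suc k) (0≤X (suc k) 1+k<N) (X-dec k 1+k<N) (0≤G⇒0≤g (suc k) 0≤G⁺) 0≤q inv′

    0≤G : ∀ k → k ℕ.< N → 0ℝ ≤ G k
    0≤G k k<N = proj₁ (invariant k k<N)

    -- The chain `q` c^(k + 1) ≤ c^(k + 1) ≤ x^(k + 1) ≤ `q` `y` a^k reverses AM-GM, so a ≤ c ≤ x,
    -- and hence `g k` ≤ 0.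
    G≤0-pred : ∀ k → suc k ℕ.< N → G (suc k) ≤ 0ℝ → G k ≤ 0ℝ
    G≤0-pred zero    _     _   = ≤-refl
    G≤0-pred (suc k) 2+k<N G≤0 = ≤0∨positive xₖ (λ x≤0 → ⊥-elim (x≤0⇒⊥ Q≤′ G≤0 x≤0))
      λ δ 0<δ δ≤x →
        let a≤c = am-gm-equality k (mean (suc k)) 0≤a 0≤c (1≤q Q≤′ G≤0 0<δ δ≤x) 0<δ (≤-trans δ≤x x≤a)
              (≤-trans (q≤1⇒q*≤ (cₖ ^ suc (suc k)) (0≤-^ (suc (suc k)) 0≤c) (G≤0⇒q≤1 Q≤′ G≤0))
              (≤-trans (^-mono-≤ (suc (suc k)) 0≤c (G≤0⇒c≤x G≤0)) x^≤qya^))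
            g≤0 : g (suc k) ≤ 0ℝ
            g≤0 = ≤-by (≤⇒0≤- (≤-trans a≤c (G≤0⇒c≤x G≤0))) λ n →
              solve 2 (λ x g → con 0ℚ :- g := x :- (x :+ g)) refl (seq xₖ n) (seq (g (suc k)) n)
        in ≤-trans (seq≡⇒≤ λ n → sym (ιg≡G (suc k) n)) (≤-trans (*-monoˡ-≤ (0≤ιᴿ (suc k)) g≤0)
             (seq≡⇒≤ λ n → ℚ.*-zeroʳ (ι (suc k))))
      where
      1+k<N = ℕ.<⇒≤ 2+k<N
      open Step (suc k) 1+k<N (0≤G (suc k) 1+k<N) (proj₂ (invariant (suc k) 1+k<N))
      Q≤′ = Q≤ (suc k) 2+k<N

    -- Two consecutive partial sums vanish, hence so does their difference.
    G≤0⇒X≃y-pred : ∀ k → suc k ℕ.< N → G (suc k) ≤ 0ℝ → X k ≃ fromℚ (y k)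
    G≤0⇒X≃y-pred k 1+k<N G⁺≤0 = ≤-antisym
      (≤-by (0≤-+ (0≤G (suc k) 1+k<N) (≤⇒0≤- (G≤0-pred k 1+k<N G⁺≤0))) λ n →
        solve 3 (λ y x G → y :- x := G :+ (y :- x) :+ (con 0ℚ :- G)) refl (y k) (seq (X k) n) (seq (G k) n))
      (≤-by (0≤-+ (≤⇒0≤- G⁺≤0) (0≤G k (ℕ.<⇒≤ 1+k<N))) λ n →
        solve 3 (λ y x G → x :- y := con 0ℚ :- (G :+ (y :- x)) :+ G) refl (y k) (seq (X k) n) (seq (G k) n))

    G≤0⇒X≃y : ∀ k → k ℕ.< N → G k ≤ 0ℝ → ∀ l → l ℕ.< k → X l ≃ fromℚ (y l)
    G≤0⇒X≃y (suc k) 1+k<N G⁺≤0 l l<1+k =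
      [ G≤0⇒X≃y k (ℕ.<⇒≤ 1+k<N) (G≤0-pred k 1+k<N G⁺≤0) l
      , (λ l≡k → subst (λ l → X l ≃ fromℚ (y l)) (sym l≡k) (G≤0⇒X≃y-pred k 1+k<N G⁺≤0))
      ]′ (ℕ.m<1+n⇒m<n∨m≡n l<1+k)

-- Reciprocals of the Sylvester sequence.

recip-∏s : ℕ → ℚ
recip-∏s k = recip (∏s k) {{∏s≢0 k}}

-- With p = `∏s k` and `s k` = p + 1 this is 1/(p(p + 1)) + 1/(p + 1) = 1/p, the identity that makes
-- the sum of the 1/s telescope.
recip-∏s-suc : ∀ k → recip-∏s (suc k) ℚ.+ recip (s k) ≡ recip-∏s k
recip-∏s-suc k = begin
  recip-∏s (suc k) ℚ.+ v                  ≡⟨ cong (ℚ._+ v) (recip-* (∏s k) (s k) {{∏s≢0 k}} {{_}} {{∏s≢0 (suc k)}}) ⟩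
  u ℚ.* v ℚ.+ v                           ≡⟨ cong (u ℚ.* v ℚ.+_) (ℚ.*-identityˡ v) ⟨
  u ℚ.* v ℚ.+ 1ℚ ℚ.* v                    ≡⟨ cong (λ w → u ℚ.* v ℚ.+ w ℚ.* v) (ι-*-recip (∏s k)) ⟨
  u ℚ.* v ℚ.+ ι (∏s k) ℚ.* u ℚ.* v        ≡⟨ solve 3 (λ u v p → u :* v :+ p :* u :* v := u :* ((con 1ℚ :+ p) :* v)) refl u v (ι (∏s k)) ⟩
  u ℚ.* (ι (s k) ℚ.* v)                   ≡⟨ cong (u ℚ.*_) (ι-*-recip (s k)) ⟩
  u ℚ.* 1ℚ                                ≡⟨ ℚ.*-identityʳ u ⟩
  u                                       ∎
  where
  open ≡-Reasoning
  instance _ = ∏s≢0 k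
  u = recip-∏s k
  v = recip (s k)

-- Entries, partial products and tail sums of a vector.

-- The default 0 past the end makes `∑-drop` hold at every index; `∏-take` is restricted to indices
-- inside the vector.
at : List ℝ → ℕ → ℝ
at []       _       = 0ℝ
at (x ∷ xs) zero    = x
at (x ∷ xs) (suc k) = at xs k

at-tabulate : ∀ {n} (x : Vector ℝ n) i → at (tabulate x) (toℕ i) ≡ x i
at-tabulate x Fin.zero    = refl
at-tabulate x (Fin.suc i) = at-tabulate (λ j → x (Fin.suc j)) i

∑-drop : ∀ xs k n → seq (∑ (drop k xs)) n ≡ seq (at xs k + ∑ (drop (suc k) xs)) n
∑-drop []       zero    n = sym (ℚ.+-identityˡ 0ℚ)
∑-drop []       (suc k) n = sym (ℚ.+-identityˡ 0ℚ)
∑-drop (x ∷ xs) zero    n = refl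
∑-drop (x ∷ xs) (suc k) n = ∑-drop xs k n

∑-drop-tabulate : ∀ {n} (x : Vector ℝ n) → ∑ (drop n (tabulate x)) ≡ 0ℝ
∑-drop-tabulate {zero}  x = refl
∑-drop-tabulate {suc n} x = ∑-drop-tabulate (λ j → x (Fin.suc j))

∏-take : ∀ {m} (x : Vector ℝ m) k → k ℕ.< m → ∀ n →
  seq (∏ (take (suc k) (tabulate x))) n ≡ seq (∏ (take k (tabulate x)) * at (tabulate x) k) n
∏-take {suc m} x zero    _         n = trans (ℚ.*-identityʳ (seq (x Fin.zero) n)) (sym (ℚ.*-identityˡ (seq (x Fin.zero) n)))
∏-take {suc m} x (suc k) (s≤s k<m) n = trans
  (cong (seq (x Fin.zero) n ℚ.*_) (∏-take (λ j → x (Fin.suc j)) k k<m n))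
  (sym (ℚ.*-assoc (seq (x Fin.zero) n) _ _))

-- The induction applied to a point of `𝒳`, with its extremal case.

module Sylvester (n : ℕ) (x : Vector ℝ n) (x∈𝒳 : 𝒳 n x) where
  open 𝒳 x∈𝒳

  X P R : ℕ → ℝ
  X k = at (toList x) k
  P k = ∏ (take k (toList x))
  R k = ∑ (drop k (toList x))

  X≡x : ∀ {k} (k<n : k ℕ.< n) → X k ≡ x (fromℕ< k<n)
  X≡x k<n = trans (cong X (sym (toℕ-fromℕ< k<n))) (at-tabulate x (fromℕ< k<n))

  0≤X : ∀ k → k ℕ.< n → 0ℝ ≤ X k
  0≤X k k<n = subst (0ℝ ≤_) (sym (X≡x k<n)) (≥0 (fromℕ< k<n))

  X-antitone : ∀ {k l} → k ℕ.≤ l → l ℕ.< n → X l ≤ X k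
  X-antitone k≤l l<n = subst₂ _≤_ (sym (X≡x l<n)) (sym (X≡x k<n))
    (decreasing (fromℕ< k<n) (fromℕ< l<n)
      (subst₂ ℕ._≤_ (sym (toℕ-fromℕ< k<n)) (sym (toℕ-fromℕ< l<n)) k≤l))
    where k<n = ℕ.≤-<-trans k≤l l<n

  open Majorisation n X (λ k → ι (s k)) (λ k → recip (s k)) (λ k → ι (∏s k))
    (λ k → 0<recip (s k)) (λ k → 0≤ι (s k)) (λ k → 0≤ι (∏s k)) (λ k → ι-*-recip (s k))
    0≤X (λ k → X-antitone (ℕ.n≤1+n k))

  -- The entries sum to 1 only up to a null sequence, so the error of the total at term `m` is
  -- carried along explicitly.
  R≡G : ∀ k m → seq (R k) m ≡ seq (G k) m ℚ.+ recip-∏s k ℚ.+ (seq (R 0) m ℚ.- 1ℚ)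
  R≡G zero    m = solve 1 (λ r → r := con 0ℚ :+ con 1ℚ :+ (r :- con 1ℚ)) refl (seq (R 0) m)
  R≡G (suc k) m = begin
    seq (R (suc k)) m
      ≡⟨ solve 2 (λ r x → r := x :+ r :- x) refl (seq (R (suc k)) m) ξ ⟩
    ξ ℚ.+ seq (R (suc k)) m ℚ.- ξ
      ≡⟨ cong (ℚ._- ξ) (∑-drop (toList x) k m) ⟨
    seq (R k) m ℚ.- ξ
      ≡⟨ cong (ℚ._- ξ) (R≡G k m) ⟩
    seq (G k) m ℚ.+ recip-∏s k ℚ.+ ρ ℚ.- ξ
      ≡⟨ cong (λ u → seq (G k) m ℚ.+ u ℚ.+ ρ ℚ.- ξ) (recip-∏s-suc k) ⟨
    seq (G k) m ℚ.+ (recip-∏s (suc k) ℚ.+ recip (s k)) ℚ.+ ρ ℚ.- ξ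
      ≡⟨ solve 5 (λ g u v r x → g :+ (u :+ v) :+ r :- x := g :+ (v :- x) :+ u :+ r) refl
           (seq (G k) m) (recip-∏s (suc k)) (recip (s k)) ρ ξ ⟩
    seq (G (suc k)) m ℚ.+ recip-∏s (suc k) ℚ.+ ρ ∎
    where
    open ≡-Reasoning
    ξ = seq (X k) m
    ρ = seq (R 0) m ℚ.- 1ℚ

  Q≡P : ∀ k → k ℕ.≤ n → ∀ m → seq (Q k) m ≡ ι (∏s k) ℚ.* seq (P k) m
  Q≡P zero    _   m = refl
  Q≡P (suc k) k<n m = begin
    seq (Q k) m ℚ.* (ι (s k) ℚ.* seq (X k) m)
      ≡⟨ cong (ℚ._* (ι (s k) ℚ.* seq (X k) m)) (Q≡P k (ℕ.<⇒≤ k<n) m) ⟩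
    ι (∏s k) ℚ.* seq (P k) m ℚ.* (ι (s k) ℚ.* seq (X k) m)
      ≡⟨ solve 4 (λ u p v x → u :* p :* (v :* x) := u :* v :* (p :* x)) refl
           (ι (∏s k)) (seq (P k) m) (ι (s k)) (seq (X k) m) ⟩
    ι (∏s k) ℚ.* ι (s k) ℚ.* (seq (P k) m ℚ.* seq (X k) m)
      ≡⟨ cong₂ ℚ._*_ (ι-* (∏s k) (s k)) (∏-take x k k<n m) ⟨
    ι (∏s (suc k)) ℚ.* seq (P (suc k)) m ∎
    where open ≡-Reasoning

  -- The product condition multiplied by `∏s (suc k)`: by `R≡G` the tail sum contributes `G (suc k)`
  -- plus the reciprocal of that factor.
  Q≤1+∏sG : ∀ k → suc k ℕ.< n → Q (suc k) ≤ 1ℝ + fromℚ (ι (∏s (suc k))) * G (suc k)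
  Q≤1+∏sG k k<n = ≤-trans (seq≡⇒≤ (Q≡P (suc k) (ℕ.<⇒≤ k<n)))
    (≤-trans (*-monoˡ-≤ {p} (0≤ιᴿ (∏s (suc k))) (prod≤sum (suc k) (s≤s z≤n) k<n))
    (≤-by (0≤-* {p} (0≤ιᴿ (∏s (suc k))) (≤⇒0≤- (≃⇒≤ sum≃1))) λ m → begin
      1ℚ ℚ.+ S ℚ.* seq (G (suc k)) m ℚ.- S ℚ.* seq (R (suc k)) m
        ≡⟨ cong₂ (λ u v → u ℚ.+ S ℚ.* seq (G (suc k)) m ℚ.- S ℚ.* v)
             (sym (ι-*-recip (∏s (suc k)))) (R≡G (suc k) m) ⟩
      S ℚ.* U ℚ.+ S ℚ.* seq (G (suc k)) m ℚ.- S ℚ.* (seq (G (suc k)) m ℚ.+ U ℚ.+ (seq (R 0) m ℚ.- 1ℚ))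
        ≡⟨ solve 4 (λ S U G r → S :* U :+ S :* G :- S :* (G :+ U :+ (r :- con 1ℚ)) := S :* (con 1ℚ :- r))
             refl S U (seq (G (suc k)) m) (seq (R 0) m) ⟩
      S ℚ.* (1ℚ ℚ.- seq (R 0) m) ∎))
    where
    open ≡-Reasoning
    instance _ = ∏s≢0 (suc k)
    S = ι (∏s (suc k))
    p = fromℚ S
    U = recip-∏s (suc k)

  -- This is `G k` ≥ 0 read through `R≡G`.
  recip-∏s≤R : ∀ k → k ℕ.< n → fromℚ (recip-∏s k) ≤ R k
  recip-∏s≤R k k<n = ≤-by (0≤-+ (0≤G Q≤1+∏sG k k<n) (≤⇒0≤- (≃⇒≤ (≃-sym sum≃1)))) λ m →
    trans (cong (ℚ._- recip-∏s k) (R≡G k m))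
      (solve 3 (λ g u r → g :+ u :+ r :- u := g :+ r) refl (seq (G k) m) (recip-∏s k) _)

  R≤recip-∏s⇒X≃recip-s : ∀ k → k ℕ.< n → R k ≤ fromℚ (recip-∏s k) →
    ∀ l → l ℕ.< k → X l ≃ fromℚ (recip (s l))
  R≤recip-∏s⇒X≃recip-s k k<n R≤U = G≤0⇒X≃y Q≤1+∏sG k k<n
    (≤-by (0≤-+ (≤⇒0≤- R≤U) (≤⇒0≤- (≃⇒≤ (≃-sym sum≃1)))) λ m →
      trans (solve 3 (λ g u r → con 0ℚ :- g := u :- (g :+ u :+ r) :+ r) refl (seq (G k) m) (recip-∏s k) _)
        (cong (λ v → recip-∏s k ℚ.- v ℚ.+ (seq (R 0) m ℚ.- 1ℚ)) (sym (R≡G k m))))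

  R-≤ : ∀ m k c → (∀ j → j ℕ.< m → X (j ℕ.+ k) ≤ c) → R k ≤ ιᴿ m * c + R (m ℕ.+ k)
  R-≤ zero    k c X≤c = seq≡⇒≤ λ i →
    solve 2 (λ c r → r := con 0ℚ :* c :+ r) refl (seq c i) (seq (R k) i)
  R-≤ (suc m) k c X≤c = ≤-trans (R-≤ m k c λ j j<m → X≤c j (ℕ.m<n⇒m<1+n j<m))
    (≤-by (≤⇒0≤- (X≤c m (ℕ.n<1+n m))) λ i → trans
      (cong (λ v → (1ℚ ℚ.+ ι m) ℚ.* seq c i ℚ.+ seq (R (suc m ℕ.+ k)) i ℚ.- (ι m ℚ.* seq c i ℚ.+ v))
        (∑-drop (toList x) (m ℕ.+ k) i))
      (solve 4 (λ m c r x → (con 1ℚ :+ m) :* c :+ r :- (m :* c :+ (x :+ r)) := c :- x) refl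
        (ι m) (seq c i) (seq (R (suc m ℕ.+ k)) i) (seq (X (m ℕ.+ k)) i)))

  R-≤-end : ∀ m k c → m ℕ.+ k ≡ n → (∀ l → k ℕ.≤ l → l ℕ.< n → X l ≤ c) → R k ≤ ιᴿ m * c
  R-≤-end m k c m+k≡n X≤c = ≤-trans
    (R-≤ m k c λ j j<m → X≤c (j ℕ.+ k) (ℕ.m≤n+m k j) (subst (j ℕ.+ k ℕ.<_) m+k≡n (ℕ.+-monoˡ-< k j<m)))
    (seq≡⇒≤ λ i → trans (cong (λ r → ι m ℚ.* seq c i ℚ.+ seq r i)
        (trans (cong R m+k≡n) (∑-drop-tabulate x)))
      (ℚ.+-identityʳ (ι m ℚ.* seq c i)))

  -- `m` counts the entries from index `k` on, and `β` is the value for which `m` equal entries add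
  -- up to exactly `recip-∏s k`.
  module Extremal (k m : ℕ) (m+k≡n : m ℕ.+ k ≡ n) (k<n : k ℕ.< n) .{{m≢0 : ℕ.NonZero m}}
    (β : ℚ) (ιm*β : ι m ℚ.* β ≡ recip-∏s k) where

    X≥β : fromℚ β ≤ X k
    X≥β = *-cancel-≤ {ιᴿ m} (0<ι m) ≤-refl
      (≤-trans (seq≡⇒≤ λ _ → ιm*β) (≤-trans (recip-∏s≤R k k<n)
        (R-≤-end m k (X k) m+k≡n λ l → X-antitone)))

    module _ (X≤β : X k ≤ fromℚ β) where

      X≤β-after : ∀ l → k ℕ.≤ l → l ℕ.< n → X l ≤ fromℚ β
      X≤β-after l k≤l l<n = ≤-trans (X-antitone k≤l l<n) X≤β

      X≃recip-s-before : ∀ l → l ℕ.< k → X l ≃ fromℚ (recip (s l))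
      X≃recip-s-before = R≤recip-∏s⇒X≃recip-s k k<n
        (≤-trans (R-≤-end m k (fromℚ β) m+k≡n X≤β-after) (seq≡⇒≤ λ _ → ιm*β))

      -- The tail from `k` is at least `m` times `β`, while the `j` entries before this one and the
      -- `j′` entries after it are at most `β` each; this leaves at least `β` for the entry itself.
      X≥β-after : ∀ j → j ℕ.+ k ℕ.< n → fromℚ β ≤ X (j ℕ.+ k)
      X≥β-after j l<n = ≤-by
        (0≤-+ (≤⇒0≤- (≤-trans (recip-∏s≤R k k<n) (R-≤ j k (fromℚ β) λ i i<j →
            X≤β-after (i ℕ.+ k) (ℕ.m≤n+m k i) (ℕ.<-trans (ℕ.+-monoˡ-< k i<j) l<n))))
          (≤⇒0≤- (R-≤-end j′ (suc (j ℕ.+ k)) (fromℚ β) j′+l≡n λ l l≥ →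
            X≤β-after l (ℕ.≤-trans (ℕ.m≤n+m k (suc j)) l≥))))
        λ i → begin
          seq (X (j ℕ.+ k)) i ℚ.- β
            ≡⟨ solve 5 (λ x r b j j′ → x :- b :=
                 j :* b :+ (x :+ r) :- (j′ :+ (con 1ℚ :+ j)) :* b :+ (j′ :* b :- r)) refl
                 (seq (X (j ℕ.+ k)) i) (r i) β (ι j) (ι j′) ⟩
          ι j ℚ.* β ℚ.+ (seq (X (j ℕ.+ k)) i ℚ.+ r i) ℚ.- (ι j′ ℚ.+ ι (suc j)) ℚ.* β ℚ.+ (ι j′ ℚ.* β ℚ.- r i)
            ≡⟨ cong₂ (λ u v → ι j ℚ.* β ℚ.+ u ℚ.- v ℚ.+ (ι j′ ℚ.* β ℚ.- r i))
                 (sym (∑-drop (toList x) (j ℕ.+ k) i)) multiplicity ⟩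
          ι j ℚ.* β ℚ.+ seq (R (j ℕ.+ k)) i ℚ.- recip-∏s k ℚ.+ (ι j′ ℚ.* β ℚ.- r i) ∎
        where
        open ≡-Reasoning
        j′ = n ℕ.∸ suc (j ℕ.+ k)
        j′+l≡n = ℕ.m∸n+n≡m l<n
        r : ℕ → ℚ
        r i = seq (R (suc (j ℕ.+ k))) i
        m≡j′+1+j : m ≡ j′ ℕ.+ suc j
        m≡j′+1+j = ℕ.+-cancelʳ-≡ k m (j′ ℕ.+ suc j)
          (trans m+k≡n (trans (sym j′+l≡n) (sym (ℕ.+-assoc j′ (suc j) k))))
        multiplicity : (ι j′ ℚ.+ ι (suc j)) ℚ.* β ≡ recip-∏s k
        multiplicity = trans (cong (ℚ._* β) (sym (trans (cong ι m≡j′+1+j) (ι-+ j′ (suc j))))) ιm*β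

-- The extremal point and the equality criterion.

x̄-before : ∀ {n} {i l : Fin n} → l Fin.< i → x̄ i l ≡ fromℚ (recip (s (toℕ l)))
x̄-before {i = i} {l} l<i = cong (if_then fromℚ (recip (s (toℕ l))) else bound i) (dec-true (l <? i) l<i)

x̄-after : ∀ {n} {i l : Fin n} → ¬ l Fin.< i → x̄ i l ≡ bound i
x̄-after {i = i} {l} l≮i = cong (if_then fromℚ (recip (s (toℕ l))) else bound i) (dec-false (l <? i) l≮i)

mainTheorem15 : (n : ℕ) (i : Fin n) (x : Vector ℝ n) → 𝒳 n x →
    (x i ≥ bound i) × ((x i ≃ bound i) ⇔ (∀ k → x k ≃ x̄ i k))
mainTheorem15 n i x x∈𝒳 =
  subst (bound i ≤_) (at-tabulate x i) X≥β ,
  mk⇔ (λ xi≃β l → extremal xi≃β l (l <? i))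
      (λ x≃x̄ → subst (x i ≃_) (x̄-after {i = i} (ℕ.<-irrefl refl)) (x≃x̄ i))
  where
  k = toℕ i
  m = n ℕ.∸ k
  instance
    m≢0 : ℕ.NonZero m
    m≢0 = ℕ.>-nonZero (ℕ.m<n⇒0<n∸m (toℕ<n i))
  open Sylvester n x x∈𝒳
  open Extremal k m (ℕ.m∸n+n≡m (ℕ.<⇒≤ (toℕ<n i))) (toℕ<n i)
    (recip (denominator i) {{denominator≢0 i}})
    -- `s k ∸ 1` reduces to `∏s k`, so `denominator i` is `m` times `∏s k` by computation.
    (ι-*-recip-* m (∏s k) {{m≢0}} {{∏s≢0 k}} {{denominator≢0 i}})

  extremal : x i ≃ bound i → ∀ l → Dec (l Fin.< i) → x l ≃ x̄ i l
  extremal xi≃β l (yes l<i) =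
    subst₂ _≃_ (at-tabulate x l) (sym (x̄-before {i = i} {l} l<i)) (X≃recip-s-before Xk≤β (toℕ l) l<i)
    where Xk≤β = subst (_≤ bound i) (sym (at-tabulate x i)) (≃⇒≤ xi≃β)
  extremal xi≃β l (no l≮i) =
    subst₂ _≃_ (trans (cong X j+k≡l) (at-tabulate x l)) (sym (x̄-after {i = i} {l} l≮i))
      (≤-antisym (X≤β-after Xk≤β (j ℕ.+ k) (ℕ.m≤n+m k j) j+k<n) (X≥β-after Xk≤β j j+k<n))
    where
    Xk≤β = subst (_≤ bound i) (sym (at-tabulate x i)) (≃⇒≤ xi≃β)
    j = toℕ l ℕ.∸ k
    j+k≡l = ℕ.m∸n+n≡m (ℕ.≮⇒≥ l≮i)
    j+k<n = subst (ℕ._< n) (sym j+k≡l) (toℕ<n l)
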